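{- Let $n\ge 1$ and, for every $i\in[n]$, let $G_i$ be a finite $d_i$-regular graph. Let $\mathbf{G}:=G_1\square\cdots\square G_n$, let $d:=d_1+\cdots+d_n$, and let $D:=\max_{i\in[n]}d_i$, where $D\ge 1$. Then, for every nonempty $A\subseteq V(\mathbf{G})$, $$e_{\mathbf{G}}(A,A^c)\ge|A|\cdot\bigl(d-D\cdot\log_{D+1}|A|\bigr).$$
   Context: $[n]$ denotes $\{1,\dots,n\}$. For a graph $G$ and $A\subseteq V(G)$, $A^c=V(G)\setminus A$ and $e_G(A,A^c)$ is the number of edges of $G$ with exactly one endpoint in $A$. The product graph $G_1\square\cdots\square G_n$ has vertex set $V(G_1)\times\cdots\times V(G_n)$, and its edges are all pairs $\{u,v\}$ for which there is an index $j\in[n]$ such that $u_jv_j\in E(G_j)$ and $u_l=v_l$ for all $l\neq j$. Graphs are simple. -}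

module Defs where

open import Data.Empty using (⊥-elim)
open import Data.Fin.Base using (Fin; zero; suc)
open import Data.Fin.Properties as Fin using (any?; all?)
open import Data.Integer.Base as ℤ using (ℤ; +_; -[1+_])
import Data.Integer.Properties as ℤ
import Data.Integer.Tactic.RingSolver as ℤSolver
open import Data.List.Base as List using (List; []; _∷_; _++_; length; filter; cartesianProduct)
open import Data.List.Membership.Propositional using (_∈_)
open import Data.List.Membership.Propositional.Properties
  using (∈-cartesianProduct⁺; ∈-filter⁺; ∈-length)
open import Data.List.Relation.Unary.Any using (here)
open import Data.List.Relation.Unary.All using ([])
open import Data.List.Relation.Unary.AllPairs using ([]; _∷_)
open import Data.List.Relation.Unary.Unique.Propositional using (Unique)
import Data.List.Relation.Unary.Unique.Propositional.Properties as Unique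
open import Data.Nat.Base as ℕ using (ℕ; zero; suc; NonZero; z≤n; s≤s)
import Data.Nat.Properties as ℕ
import Data.Nat.Tactic.RingSolver as ℕSolver
open import Data.Product.Base using (Σ-syntax; ∃; ∃₂; _×_; _,_; proj₁; proj₂)
open import Data.Product.Properties using (≡-dec)
open import Data.Rational.Base as ℚ using (ℚ; mkℚ; 0ℚ; 1ℚ; ½; ↥_; ↧_; ↧ₙ_; *<*; toℚᵘ; fromℚᵘ)
import Data.Rational.Properties as ℚ
open import Data.Rational.Solver using (module +-*-Solver)
open import Data.Rational.Unnormalised.Base as ℚᵘ using (ℚᵘ; mkℚᵘ)
import Data.Rational.Unnormalised.Properties as ℚᵘ
open import Data.Sum.Base using (_⊎_; inj₁; inj₂; map; swap)
open import Data.Unit.Base using (⊤; tt)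
open import Data.Unit.Properties using () renaming (_≟_ to _≟⊤_)
open import Data.Vec.Base as Vec using (Vec; []; _∷_; lookup)
open import Level using (0ℓ)
open import Relation.Binary.Core using (Rel)
open import Relation.Binary.Definitions using (DecidableEquality; tri<; tri≈; tri>)
import Relation.Binary.Definitions as B
open import Relation.Binary.PropositionalEquality
open import Relation.Nullary.Decidable using (Dec; yes; no; ¬?; _×-dec_; _⊎-dec_; _→-dec_)
open import Relation.Nullary.Negation using (¬_)
open import Relation.Unary using (Pred; Decidable)

-- Two-sided Dedekind cuts: lower q means q < x, upper q means x < q.
record ℝ : Set₁ where
  field
    lower upper     : Pred ℚ 0ℓ
    lower-inhabited : ∃ lower
    upper-inhabited : ∃ upper
    lower-closed    : ∀ {q r} → q ℚ.< r → lower r → lower q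
    upper-closed    : ∀ {q r} → q ℚ.< r → upper q → upper r
    lower-open      : ∀ {q} → lower q → Σ[ r ∈ ℚ ] q ℚ.< r × lower r
    upper-open      : ∀ {r} → upper r → Σ[ q ∈ ℚ ] q ℚ.< r × upper q
    disjoint        : ∀ {q} → lower q → ¬ upper q
    located         : ∀ {q r} → q ℚ.< r → lower q ⊎ upper r

open ℝ

infix  4 _≤ᴿ_ _≥ᴿ_
infixl 6 _+ᴿ_ _-ᴿ_
infix  8 -ᴿ_
infixr 7 _·_

_≤ᴿ_ : ℝ → ℝ → Set
x ≤ᴿ y = ∀ {q} → lower x q → lower y q

_≥ᴿ_ : ℝ → ℝ → Set
x ≥ᴿ y = y ≤ᴿ x

q-1<q : ∀ q → q ℚ.- 1ℚ ℚ.< q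
q-1<q q = subst (q ℚ.- 1ℚ ℚ.<_) (ℚ.+-identityʳ q)
  (ℚ.+-monoʳ-< q {ℚ.- 1ℚ} {0ℚ} (*<* ℤ.-<+))

q<q+1 : ∀ q → q ℚ.< q ℚ.+ 1ℚ
q<q+1 q = subst (ℚ._< q ℚ.+ 1ℚ) (ℚ.+-identityʳ q)
  (ℚ.+-monoʳ-< q {0ℚ} {1ℚ} (*<* (ℤ.+<+ (s≤s z≤n))))

lower<upper : ∀ x {q r} → lower x q → upper x r → q ℚ.< r
lower<upper x {q} {r} l u with ℚ.<-cmp q r
... | tri< q<r _ _  = q<r
... | tri≈ _ refl _ = ⊥-elim (disjoint x l u)
... | tri> _ _ r<q  = ⊥-elim (disjoint x (lower-closed x r<q l) u)

fromℚ : ℚ → ℝ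
fromℚ p = record
  { lower           = ℚ._< p
  ; upper           = p ℚ.<_
  ; lower-inhabited = p ℚ.- 1ℚ , q-1<q p
  ; upper-inhabited = p ℚ.+ 1ℚ , q<q+1 p
  ; lower-closed    = ℚ.<-trans
  ; upper-closed    = λ q<r p<q → ℚ.<-trans p<q q<r
  ; lower-open      = λ q<p → let m , q<m , m<p = ℚ.<-dense q<p in m , q<m , m<p
  ; upper-open      = λ p<r → let m , p<m , m<r = ℚ.<-dense p<r in m , m<r , p<m
  ; disjoint        = ℚ.<-asym
  ; located         = loc
  }
  where
  loc : ∀ {q r} → q ℚ.< r → q ℚ.< p ⊎ p ℚ.< r
  loc {q} {r} q<r with q ℚ.<? p
  ... | yes q<p = inj₁ q<p
  ... | no  q≮p = inj₂ (ℚ.≤-<-trans (ℚ.≮⇒≥ q≮p) q<r)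

fromℕ : ℕ → ℝ
fromℕ n = fromℚ (+ n ℚ./ 1)

-ᴿ_ : ℝ → ℝ
-ᴿ x = record
  { lower           = λ q → upper x (ℚ.- q)
  ; upper           = λ q → lower x (ℚ.- q)
  ; lower-inhabited = let q , u = upper-inhabited x in ℚ.- q , subst (upper x) (sym (neg-inv q)) u
  ; upper-inhabited = let q , l = lower-inhabited x in ℚ.- q , subst (lower x) (sym (neg-inv q)) l
  ; lower-closed    = λ q<r → upper-closed x (ℚ.neg-antimono-< q<r)
  ; upper-closed    = λ q<r → lower-closed x (ℚ.neg-antimono-< q<r)
  ; lower-open      = λ {q} u → let r , r<-q , ur = upper-open x u in
      ℚ.- r , subst (ℚ._< ℚ.- r) (neg-inv q) (ℚ.neg-antimono-< r<-q) ,
      subst (upper x) (sym (neg-inv r)) ur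
  ; upper-open      = λ {q} l → let r , -q<r , lr = lower-open x l in
      ℚ.- r , subst (ℚ.- r ℚ.<_) (neg-inv q) (ℚ.neg-antimono-< -q<r) ,
      subst (lower x) (sym (neg-inv r)) lr
  ; disjoint        = λ u l → disjoint x l u
  ; located         = λ q<r → swap (located x (ℚ.neg-antimono-< q<r))
  }
  where
  open import Algebra.Properties.Group ℚ.+-0-group using () renaming (⁻¹-involutive to neg-inv)

module _ where
  open +-*-Solver

  shift : ∀ a b c → a ℚ.+ (b ℚ.+ c) ≡ (a ℚ.+ b) ℚ.+ c
  shift = solve 3 (λ a b c → a :+ (b :+ c) := (a :+ b) :+ c) refl

  a+[b-a] : ∀ a b → a ℚ.+ (b ℚ.- a) ≡ b
  a+[b-a] = solve 2 (λ a b → a :+ (b :- a) := b) refl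

  cross : ∀ q r l e → (q ℚ.- l) ℚ.+ ((r ℚ.- q) ℚ.- e) ≡ r ℚ.- (l ℚ.+ e)
  cross = solve 4 (λ q r l e → (q :- l) :+ ((r :- q) :- e) := r :- (l :+ e)) refl

infixr 7 _×ℚ_
_×ℚ_ : ℕ → ℚ → ℚ
zero  ×ℚ δ = 0ℚ
suc n ×ℚ δ = δ ℚ.+ n ×ℚ δ

×ℚ-* : ∀ n δ → n ×ℚ δ ≡ (+ n ℚ./ 1) ℚ.* δ
×ℚ-* zero    δ = sym (ℚ.*-zeroˡ δ)
×ℚ-* (suc n) δ = begin
  δ ℚ.+ n ×ℚ δ                      ≡⟨ cong (δ ℚ.+_) (×ℚ-* n δ) ⟩
  δ ℚ.+ (+ n ℚ./ 1) ℚ.* δ           ≡⟨ factor δ (+ n ℚ./ 1) ⟩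
  (1ℚ ℚ.+ (+ n ℚ./ 1)) ℚ.* δ        ≡⟨ cong (ℚ._* δ) step ⟩
  (+ suc n ℚ./ 1) ℚ.* δ             ∎
  where
  open ≡-Reasoning
  factor : ∀ δ n → δ ℚ.+ n ℚ.* δ ≡ (1ℚ ℚ.+ n) ℚ.* δ
  factor δ n = begin
    δ ℚ.+ n ℚ.* δ            ≡⟨ cong (ℚ._+ n ℚ.* δ) (sym (ℚ.*-identityˡ δ)) ⟩
    1ℚ ℚ.* δ ℚ.+ n ℚ.* δ     ≡⟨ sym (ℚ.*-distribʳ-+ δ 1ℚ n) ⟩
    (1ℚ ℚ.+ n) ℚ.* δ         ∎
  units : ∀ i → (ℤ.1ℤ ℤ.* ℤ.1ℤ ℤ.+ i ℤ.* ℤ.1ℤ) ℤ.* ℤ.1ℤ ≡ (ℤ.1ℤ ℤ.+ i) ℤ.* ℤ.1ℤ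
  units = ℤSolver.solve-∀
  step : 1ℚ ℚ.+ (+ n ℚ./ 1) ≡ + suc n ℚ./ 1
  step = ℚ.toℚᵘ-injective (ℚᵘ.≃-trans (ℚ.toℚᵘ-homo-+ 1ℚ (+ n ℚ./ 1))
    (ℚᵘ.≃-trans (ℚᵘ.+-congʳ (toℚᵘ 1ℚ) (ℚ.toℚᵘ-fromℚᵘ (mkℚᵘ (+ n) 0)))
    (ℚᵘ.≃-trans (ℚᵘ.*≡* (units (+ n)))
    (ℚᵘ.≃-sym (ℚ.toℚᵘ-fromℚᵘ (mkℚᵘ (+ suc n) 0))))))

≤-natural : ∀ q → Σ[ n ∈ ℕ ] q ℚ.≤ + n ℚ./ 1
≤-natural q@record{} = ℤ.∣ ↥ q ∣ , ℚ.toℚᵘ-cancel-≤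
  (ℚᵘ.≤-trans (ℚᵘ.*≤* le)
    (ℚᵘ.≤-reflexive (ℚᵘ.≃-sym (ℚ.toℚᵘ-fromℚᵘ (mkℚᵘ (+ ℤ.∣ ↥ q ∣) 0)))))
  where
  i≤∣i∣ : ∀ i → i ℤ.≤ + ℤ.∣ i ∣
  i≤∣i∣ (+ n)    = ℤ.≤-refl
  i≤∣i∣ -[1+ n ] = ℤ.-≤+
  le : ↥ q ℤ.* ℤ.1ℤ ℤ.≤ + ℤ.∣ ↥ q ∣ ℤ.* ↧ q
  le = ℤ.≤-trans (ℤ.≤-reflexive (ℤ.*-identityʳ (↥ q)))
    (ℤ.≤-trans (i≤∣i∣ (↥ q))
    (subst (+ ℤ.∣ ↥ q ∣ ℤ.≤_) (ℤ.pos-* ℤ.∣ ↥ q ∣ (↧ₙ q))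
      (ℤ.+≤+ (ℕ.m≤m*n ℤ.∣ ↥ q ∣ (↧ₙ q)))))

archimedean : ∀ {δ} → 0ℚ ℚ.< δ → ∀ q → Σ[ n ∈ ℕ ] q ℚ.≤ n ×ℚ δ
archimedean {δ} 0<δ q = n , subst (q ℚ.≤_) (sym (×ℚ-* n δ))
  (subst (ℚ._≤ (+ n ℚ./ 1) ℚ.* δ) q/δ*δ (ℚ.*-monoʳ-≤-nonNeg δ q/δ≤n))
  where
  instance
    δ>0 : ℚ.Positive δ
    δ>0 = ℚ.positive 0<δ
    δ≥0 : ℚ.NonNegative δ
    δ≥0 = ℚ.pos⇒nonNeg δ
    δ≢0 : ℚ.NonZero δ
    δ≢0 = ℚ.pos⇒nonZero δ
  n = proj₁ (≤-natural (q ℚ.* ℚ.1/ δ))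
  q/δ≤n = proj₂ (≤-natural (q ℚ.* ℚ.1/ δ))
  q/δ*δ : q ℚ.* ℚ.1/ δ ℚ.* δ ≡ q
  q/δ*δ = trans (ℚ.*-assoc q _ δ) (trans (cong (q ℚ.*_) (ℚ.*-inverseˡ δ)) (ℚ.*-identityʳ q))

halve : ∀ {ε} → 0ℚ ℚ.< ε → Σ[ δ ∈ ℚ ] 0ℚ ℚ.< δ × δ ℚ.+ δ ≡ ε
halve {ε} 0<ε = ½ ℚ.* ε , subst (ℚ._< ½ ℚ.* ε) (ℚ.*-zeroʳ ½) (ℚ.*-monoʳ-<-pos ½ 0<ε) ,
  trans (sym (ℚ.*-distribʳ-+ ε ½ ½)) (ℚ.*-identityˡ ε)

approximate : ∀ x {ε} → 0ℚ ℚ.< ε → Σ[ l ∈ ℚ ] lower x l × upper x (l ℚ.+ ε)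
approximate x {ε} 0<ε = go n l₀ lower-l₀ far
  where
  δ = proj₁ (halve 0<ε)
  0<δ = proj₁ (proj₂ (halve 0<ε))
  δ+δ≡ε = proj₂ (proj₂ (halve 0<ε))
  l₀ = proj₁ (lower-inhabited x)
  lower-l₀ = proj₂ (lower-inhabited x)
  u₀ = proj₁ (upper-inhabited x)
  n = suc (proj₁ (archimedean 0<δ (u₀ ℚ.- l₀)))
  far : upper x (l₀ ℚ.+ n ×ℚ δ)
  far = upper-closed x
    (subst (ℚ._< l₀ ℚ.+ n ×ℚ δ) (a+[b-a] l₀ u₀)
      (ℚ.+-monoʳ-< l₀
        (subst (ℚ._< n ×ℚ δ) (ℚ.+-identityˡ (u₀ ℚ.- l₀))
          (ℚ.+-mono-<-≤ 0<δ (proj₂ (archimedean 0<δ (u₀ ℚ.- l₀)))))))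
    (proj₂ (upper-inhabited x))
  go : ∀ n l → lower x l → upper x (l ℚ.+ n ×ℚ δ) → Σ[ l ∈ ℚ ] lower x l × upper x (l ℚ.+ ε)
  go zero l lo up = ⊥-elim (disjoint x lo (subst (upper x) (ℚ.+-identityʳ l) up))
  go (suc n) l lo up
    with located x (ℚ.+-monoʳ-< l (subst (ℚ._< δ ℚ.+ δ) (ℚ.+-identityʳ δ) (ℚ.+-monoʳ-< δ 0<δ)))
  ... | inj₁ lo′ = go n (l ℚ.+ δ) lo′ (subst (upper x) (shift l δ (n ×ℚ δ)) up)
  ... | inj₂ up′ = l , lo , subst (λ e → upper x (l ℚ.+ e)) δ+δ≡ε up′

0<r-q : ∀ {q r} → q ℚ.< r → 0ℚ ℚ.< r ℚ.- q
0<r-q {q} {r} q<r = subst (ℚ._< r ℚ.- q) (ℚ.+-inverseʳ q) (ℚ.+-monoˡ-< (ℚ.- q) q<r)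

_+ᴿ_ : ℝ → ℝ → ℝ
x +ᴿ y = record
  { lower           = L
  ; upper           = U
  ; lower-inhabited =
      let a , la = lower-inhabited x ; b , lb = lower-inhabited y in
      (a ℚ.+ b) ℚ.- 1ℚ , a , b , la , lb , q-1<q (a ℚ.+ b)
  ; upper-inhabited =
      let a , ua = upper-inhabited x ; b , ub = upper-inhabited y in
      (a ℚ.+ b) ℚ.+ 1ℚ , a , b , ua , ub , q<q+1 (a ℚ.+ b)
  ; lower-closed    = λ q<r (a , b , la , lb , r<a+b) → a , b , la , lb , ℚ.<-trans q<r r<a+b
  ; upper-closed    = λ q<r (a , b , ua , ub , a+b<q) → a , b , ua , ub , ℚ.<-trans a+b<q q<r
  ; lower-open      = λ (a , b , la , lb , q<a+b) →
      let m , q<m , m<a+b = ℚ.<-dense q<a+b in m , q<m , a , b , la , lb , m<a+b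
  ; upper-open      = λ (a , b , ua , ub , a+b<r) →
      let m , a+b<m , m<r = ℚ.<-dense a+b<r in m , m<r , a , b , ua , ub , a+b<m
  ; disjoint        = λ (a , b , la , lb , q<a+b) (c , d , uc , ud , c+d<q) →
      ℚ.<-asym (ℚ.<-trans c+d<q q<a+b) (ℚ.+-mono-< (lower<upper x la uc) (lower<upper y lb ud))
  ; located         = loc
  }
  where
  L U : Pred ℚ 0ℓ
  L q = ∃₂ λ a b → lower x a × lower y b × q ℚ.< a ℚ.+ b
  U q = ∃₂ λ a b → upper x a × upper y b × a ℚ.+ b ℚ.< q

  fromˡ : ∀ q l → lower x l → lower y (q ℚ.- l) → L q
  fromˡ q l lo lo′ =
    let l′ , l<l′ , lo″ = lower-open x lo in
    l′ , q ℚ.- l , lo″ , lo′ ,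
    subst (ℚ._< l′ ℚ.+ (q ℚ.- l)) (a+[b-a] l q) (ℚ.+-monoˡ-< (q ℚ.- l) l<l′)

  fromʳ : ∀ r u → upper x u → upper y (r ℚ.- u) → U r
  fromʳ r u up up′ =
    let u′ , u′<u , up″ = upper-open x up in
    u′ , r ℚ.- u , up″ , up′ ,
    subst (u′ ℚ.+ (r ℚ.- u) ℚ.<_) (a+[b-a] u r) (ℚ.+-monoˡ-< (r ℚ.- u) u′<u)

  gap : ∀ q r l ε → ε ℚ.< r ℚ.- q → q ℚ.- l ℚ.< r ℚ.- (l ℚ.+ ε)
  gap q r l ε ε<r-q = subst₂ ℚ._<_ (ℚ.+-identityʳ (q ℚ.- l)) (cross q r l ε)
    (ℚ.+-monoʳ-< (q ℚ.- l) (0<r-q ε<r-q))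

  loc : ∀ {q r} → q ℚ.< r → L q ⊎ U r
  loc {q} {r} q<r =
    let ε , 0<ε , ε<r-q = ℚ.<-dense (0<r-q q<r)
        l , lo , up     = approximate x 0<ε
    in map (fromˡ q l lo) (fromʳ r (l ℚ.+ ε) up) (located y (gap q r l ε ε<r-q))

_-ᴿ_ : ℝ → ℝ → ℝ
x -ᴿ y = x +ᴿ (-ᴿ y)

_·_ : ℕ → ℝ → ℝ
zero  · x = fromℕ 0
suc n · x = x +ᴿ n · x

posPart negPart : ℤ → ℕ
posPart (+ n)    = n
posPart -[1+ n ] = 0
negPart (+ n)    = 0
negPart -[1+ n ] = suc n

-- Pow< b a q says b ^ q < a, and Pow> b a q says a < b ^ q.
-- For q = i / n in lowest terms, the inequality b ^ (i / n) < a
-- between real numbers reads b ^ i < a ^ n; multiplying by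
-- b ^ negPart i leaves only natural exponents.

Pow< Pow> : ℕ → ℕ → ℚ → Set
Pow< b a q = b ℕ.^ posPart (↥ q) ℕ.< a ℕ.^ ↧ₙ q ℕ.* b ℕ.^ negPart (↥ q)
Pow> b a q = a ℕ.^ ↧ₙ q ℕ.* b ℕ.^ negPart (↥ q) ℕ.< b ℕ.^ posPart (↥ q)

module LogLaws (b a : ℕ) (1<b : 1 ℕ.< b) (0<a : 0 ℕ.< a) where
  open import Data.Nat.Base using (_+_; _*_; _^_; _≤_; _<_)
  open import Data.Nat.Properties

  instance
    b≢0 : NonZero b
    b≢0 = ℕ.>-nonZero (<-trans (s≤s z≤n) 1<b)
    a≢0 : NonZero a
    a≢0 = ℕ.>-nonZero 0<a

  ^-distribʳ-* : ∀ x y j → (x * y) ^ j ≡ x ^ j * y ^ j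
  ^-distribʳ-* x y zero    = refl
  ^-distribʳ-* x y (suc j) =
    trans (cong (x * y *_) (^-distribʳ-* x y j)) (interchange x y (x ^ j) (y ^ j))
    where
    interchange : ∀ x y z w → x * y * (z * w) ≡ x * z * (y * w)
    interchange = ℕSolver.solve-∀

  raise : ∀ v k j → (a ^ k * b ^ v) ^ j ≡ a ^ (k * j) * b ^ (v * j)
  raise v k j = trans (^-distribʳ-* (a ^ k) (b ^ v) j) (cong₂ _*_ (^-*-assoc a k j) (^-*-assoc b v j))

  ^-cancel-≤ : ∀ {x y} → b ^ x ≤ b ^ y → x ≤ y
  ^-cancel-≤ le = ≮⇒≥ λ lt → <⇒≱ (^-monoʳ-< b 1<b lt) le

  ^-cancel-< : ∀ {x y} → b ^ x < b ^ y → x < y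
  ^-cancel-< lt = ≰⇒> λ le → ≤⇒≯ (^-monoʳ-≤ b le) lt

  -- Comparison of (u - v) / k with (P - N) / n through
  -- their position relative to the logarithm.
  module _ (P N n u v k : ℕ) where
    X  = a ^ n * b ^ N
    Y  = a ^ k * b ^ v

    left : b ^ (u * n + N * k) ≡ (b ^ u) ^ n * b ^ (N * k)
    left = trans (^-distribˡ-+-* b (u * n) (N * k)) (cong (_* b ^ (N * k)) (sym (^-*-assoc b u n)))

    middle : Y ^ n * b ^ (N * k) ≡ b ^ (v * n) * X ^ k
    middle rewrite raise v k n | raise N n k | *-comm n k = permute (a ^ (k * n)) (b ^ (v * n)) (b ^ (N * k))
      where
      permute : ∀ x y z → x * y * z ≡ y * (x * z)
      permute = ℕSolver.solve-∀

    right : b ^ (v * n) * (b ^ P) ^ k ≡ b ^ (v * n + P * k)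
    right = trans (cong (b ^ (v * n) *_) (^-*-assoc b P k)) (sym (^-distribˡ-+-* b (v * n) (P * k)))

    open ≤-Reasoning

    compare : b ^ u ≤ Y → X ≤ b ^ P → u * n + N * k ≤ v * n + P * k
    compare g f = ^-cancel-≤ (begin
      b ^ (u * n + N * k)        ≡⟨ left ⟩
      (b ^ u) ^ n * b ^ (N * k)  ≤⟨ *-monoˡ-≤ (b ^ (N * k)) (^-monoˡ-≤ n g) ⟩
      Y ^ n * b ^ (N * k)        ≡⟨ middle ⟩
      b ^ (v * n) * X ^ k        ≤⟨ *-monoʳ-≤ (b ^ (v * n)) (^-monoˡ-≤ k f) ⟩
      b ^ (v * n) * (b ^ P) ^ k  ≡⟨ right ⟩
      b ^ (v * n + P * k)        ∎)

    compare-<ˡ : .{{_ : NonZero n}} → b ^ u < Y → X ≤ b ^ P → u * n + N * k < v * n + P * k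
    compare-<ˡ g f = ^-cancel-< (begin-strict
      b ^ (u * n + N * k)        ≡⟨ left ⟩
      (b ^ u) ^ n * b ^ (N * k)  <⟨ *-monoˡ-< (b ^ (N * k)) {{m^n≢0 b (N * k)}} (^-monoˡ-< n g) ⟩
      Y ^ n * b ^ (N * k)        ≡⟨ middle ⟩
      b ^ (v * n) * X ^ k        ≤⟨ *-monoʳ-≤ (b ^ (v * n)) (^-monoˡ-≤ k f) ⟩
      b ^ (v * n) * (b ^ P) ^ k  ≡⟨ right ⟩
      b ^ (v * n + P * k)        ∎)

    compare-<ʳ : .{{_ : NonZero k}} → b ^ u ≤ Y → X < b ^ P → u * n + N * k < v * n + P * k
    compare-<ʳ g f = ^-cancel-< (begin-strict
      b ^ (u * n + N * k)        ≡⟨ left ⟩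
      (b ^ u) ^ n * b ^ (N * k)  ≤⟨ *-monoˡ-≤ (b ^ (N * k)) (^-monoˡ-≤ n g) ⟩
      Y ^ n * b ^ (N * k)        ≡⟨ middle ⟩
      b ^ (v * n) * X ^ k        <⟨ *-monoʳ-< (b ^ (v * n)) {{m^n≢0 b (v * n)}} (^-monoˡ-< k f) ⟩
      b ^ (v * n) * (b ^ P) ^ k  ≡⟨ right ⟩
      b ^ (v * n + P * k)        ∎)

  parts : ∀ i → i ≡ + posPart i ℤ.- + negPart i
  parts (+ n)    = sym (ℤ.+-identityʳ (+ n))
  parts -[1+ n ] = refl

  pos-cross : ∀ u n v k → + (u * n + v * k) ≡ + u ℤ.* + n ℤ.+ + v ℤ.* + k
  pos-cross u n v k = trans (ℤ.pos-+ (u * n) (v * k)) (cong₂ ℤ._+_ (ℤ.pos-* u n) (ℤ.pos-* v k))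

  rearrangeˡ : ∀ P N m N′ n →
    (P ℤ.- N) ℤ.* m ℤ.+ (N ℤ.* m ℤ.+ N′ ℤ.* n) ≡ P ℤ.* m ℤ.+ N′ ℤ.* n
  rearrangeˡ = ℤSolver.solve-∀

  rearrangeʳ : ∀ P′ N′ n N m →
    (P′ ℤ.- N′) ℤ.* n ℤ.+ (N ℤ.* m ℤ.+ N′ ℤ.* n) ≡ N ℤ.* m ℤ.+ P′ ℤ.* n
  rearrangeʳ = ℤSolver.solve-∀

  cross-< : ∀ P N m P′ N′ n → (+ P ℤ.- + N) ℤ.* + m ℤ.< (+ P′ ℤ.- + N′) ℤ.* + n →
    P * m + N′ * n < N * m + P′ * n
  cross-< P N m P′ N′ n lt = ℤ.drop‿+<+ (subst₂ ℤ._<_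
    (trans (rearrangeˡ (+ P) (+ N) (+ m) (+ N′) (+ n)) (sym (pos-cross P m N′ n)))
    (trans (rearrangeʳ (+ P′) (+ N′) (+ n) (+ N) (+ m)) (sym (pos-cross N m P′ n)))
    (ℤ.+-monoˡ-< (+ N ℤ.* + m ℤ.+ + N′ ℤ.* + n) lt))

  cross-≡ : ∀ P N m P′ N′ n → (+ P ℤ.- + N) ℤ.* + m ≡ (+ P′ ℤ.- + N′) ℤ.* + n →
    P * m + N′ * n ≡ N * m + P′ * n
  cross-≡ P N m P′ N′ n eq = ℤ.+-injective (begin
    + (P * m + N′ * n)                                               ≡⟨ pos-cross P m N′ n ⟩
    + P ℤ.* + m ℤ.+ + N′ ℤ.* + n                                     ≡⟨ rearrangeˡ (+ P) (+ N) (+ m) (+ N′) (+ n) ⟨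
    (+ P ℤ.- + N) ℤ.* + m ℤ.+ (+ N ℤ.* + m ℤ.+ + N′ ℤ.* + n)         ≡⟨ cong (ℤ._+ _) eq ⟩
    (+ P′ ℤ.- + N′) ℤ.* + n ℤ.+ (+ N ℤ.* + m ℤ.+ + N′ ℤ.* + n)       ≡⟨ rearrangeʳ (+ P′) (+ N′) (+ n) (+ N) (+ m) ⟩
    + N ℤ.* + m ℤ.+ + P′ ℤ.* + n                                     ≡⟨ pos-cross N m P′ n ⟨
    + (N * m + P′ * n)                                               ∎)
    where open ≡-Reasoning

  crossing : ∀ {q r} → q ℚ.< r →
    posPart (↥ q) * ↧ₙ r + negPart (↥ r) * ↧ₙ q < negPart (↥ q) * ↧ₙ r + posPart (↥ r) * ↧ₙ q
  crossing {q} {r} (*<* lt) = cross-< (posPart (↥ q)) (negPart (↥ q)) (↧ₙ r) (posPart (↥ r)) (negPart (↥ r)) (↧ₙ q)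
    (subst₂ (λ i j → i ℤ.* ↧ r ℤ.< j ℤ.* ↧ q) (parts (↥ q)) (parts (↥ r)) lt)

  K : ∀ {q r} → q ℚ.< r → ¬ Pow> b a r → Pow< b a q
  K {q} {r} q<r r≤log = ≰⇒> λ q≥log → <⇒≱ (crossing q<r)
    (subst₂ _≤_ (+-comm (posPart (↥ r) * ↧ₙ q) _) (+-comm (negPart (↥ r) * ↧ₙ q) _)
      (compare (posPart (↥ q)) (negPart (↥ q)) (↧ₙ q) (posPart (↥ r)) (negPart (↥ r)) (↧ₙ r)
        (≮⇒≥ r≤log) q≥log))

  frac : ℕ → ℕ → (k : ℕ) .{{_ : NonZero k}} → ℚ
  frac u v (suc k) = fromℚᵘ (mkℚᵘ (+ u ℤ.- + v) k)

  frac-cross : ∀ u v k .{{_ : NonZero k}} → let q = frac u v k in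
    posPart (↥ q) * k + v * ↧ₙ q ≡ negPart (↥ q) * k + u * ↧ₙ q
  frac-cross u v (suc k) with frac u v (suc k) | ℚ.toℚᵘ-fromℚᵘ (mkℚᵘ (+ u ℤ.- + v) k)
  ... | q@(mkℚ i _ _) | ℚᵘ.*≡* eq = cross-≡ (posPart i) (negPart i) (suc k) u v (↧ₙ q)
    (trans (cong (ℤ._* + suc k) (sym (parts i))) eq)

  frac-lower : ∀ u v k .{{_ : NonZero k}} → b ^ u < a ^ k * b ^ v → Pow< b a (frac u v k)
  frac-lower u v k lt = ≰⇒> λ ge → <-irrefl
    (trans (+-comm (u * ↧ₙ q) _) (trans (sym (frac-cross u v k)) (+-comm _ (v * ↧ₙ q))))
    (compare-<ˡ (posPart (↥ q)) (negPart (↥ q)) (↧ₙ q) u v k lt ge)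
    where q = frac u v k

  frac-upper : ∀ u v k .{{_ : NonZero k}} → a ^ k * b ^ v < b ^ u → Pow> b a (frac u v k)
  frac-upper u v k lt = ≰⇒> λ le → <-irrefl (frac-cross u v k)
    (compare-<ʳ u v k (posPart (↥ q)) (negPart (↥ q)) (↧ₙ q) le lt)
    where q = frac u v k

  <-frac : ∀ q u v k .{{_ : NonZero k}} → (↥ q) ℤ.* + k ℤ.< (+ u ℤ.- + v) ℤ.* ↧ q → q ℚ.< frac u v k
  <-frac q@record{} u v (suc k) lt = ℚ.toℚᵘ-cancel-< (ℚᵘ.<-respʳ-≃
    (ℚᵘ.≃-sym (ℚ.toℚᵘ-fromℚᵘ (mkℚᵘ (+ u ℤ.- + v) k))) (ℚᵘ.*<* lt))

  frac-< : ∀ q u v k .{{_ : NonZero k}} → (+ u ℤ.- + v) ℤ.* ↧ q ℤ.< (↥ q) ℤ.* + k → frac u v k ℚ.< q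
  frac-< q@record{} u v (suc k) lt = ℚ.toℚᵘ-cancel-< (ℚᵘ.<-respˡ-≃
    (ℚᵘ.≃-sym (ℚ.toℚᵘ-fromℚᵘ (mkℚᵘ (+ u ℤ.- + v) k))) (ℚᵘ.*<* lt))

  bernoulli : ∀ x j → x ^ j * (x + j) ≤ (suc x) ^ j * x
  bernoulli x zero    = ≤-reflexive (cong (_+ 0) (+-identityʳ x))
  bernoulli x (suc j) = begin
    x * x ^ j * (x + suc j)           ≤⟨ m≤m+n _ (x ^ j * j) ⟩
    x * x ^ j * (x + suc j) + x ^ j * j ≡⟨ e₁ x j (x ^ j) ⟩
    suc x * (x ^ j * (x + j))         ≤⟨ *-monoʳ-≤ (suc x) (bernoulli x j) ⟩
    suc x * (suc x ^ j * x)           ≡⟨ *-assoc (suc x) (suc x ^ j) x ⟨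
    suc x * suc x ^ j * x             ∎
    where
    open ≤-Reasoning
    e₁ : ∀ x j p → x * p * (x + suc j) + p * j ≡ suc x * (p * (x + j))
    e₁ = ℕSolver.solve-∀

  magnify : ∀ x y .{{_ : NonZero x}} → x < y → b * x ^ (b * x) < y ^ (b * x)
  magnify x y x<y = *-cancelʳ-< x _ _ (begin-strict
    b * p * x              <⟨ m<n+m (b * p * x) (>-nonZero⁻¹ (p * x) {{m*n≢0 p x {{m^n≢0 x j}}}}) ⟩
    p * x + b * p * x      ≡⟨ e₂ b p x ⟩
    p * (x + b * x)        ≤⟨ bernoulli x j ⟩
    suc x ^ j * x          ≤⟨ *-monoˡ-≤ x (^-monoˡ-≤ j x<y) ⟩
    y ^ j * x              ∎)
    where
    open ≤-Reasoning
    open import Data.Nat.Base using (>-nonZero⁻¹)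
    j = b * x
    p = x ^ j
    e₂ : ∀ b p x → p * x + b * p * x ≡ p * (x + b * x)
    e₂ = ℕSolver.solve-∀

  module _ (q : ℚ) where
    private
      P = posPart (↥ q)
      N = negPart (↥ q)
      n = ↧ₙ q
      W = a ^ n * b ^ N
      instance
        W≢0 : NonZero W
        W≢0 = m*n≢0 (a ^ n) (b ^ N) {{m^n≢0 a n}} {{m^n≢0 b N}}
        bP≢0 : NonZero (b ^ P)
        bP≢0 = m^n≢0 b P

    e₃ : ∀ (P N n j : ℤ) → (ℤ.1ℤ ℤ.+ P ℤ.* j ℤ.- N ℤ.* j) ℤ.* n ≡ (P ℤ.- N) ℤ.* (n ℤ.* j) ℤ.+ n
    e₃ = ℤSolver.solve-∀

    e₄ : ∀ (P N n j : ℤ) → (P ℤ.* j ℤ.- (ℤ.1ℤ ℤ.+ N ℤ.* j)) ℤ.* n ℤ.+ n ≡ (P ℤ.- N) ℤ.* (n ℤ.* j)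
    e₄ = ℤSolver.solve-∀

    cast : ∀ x y → + suc (x * y) ≡ ℤ.1ℤ ℤ.+ + x ℤ.* + y
    cast x y = trans (ℤ.pos-+ 1 (x * y)) (cong (ℤ._+_ ℤ.1ℤ) (ℤ.pos-* x y))

    i<i+n : ∀ i → i ℤ.< i ℤ.+ + n
    i<i+n i = subst (ℤ._< i ℤ.+ + n) (ℤ.+-identityʳ i) (ℤ.+-monoʳ-< i {ℤ.0ℤ} {+ n} (ℤ.+<+ (s≤s z≤n)))

    openˡ : Pow< b a q → Σ[ r ∈ ℚ ] q ℚ.< r × Pow< b a r
    openˡ lt = frac u v k , <-frac q u v k below , frac-lower u v k powers
      where
      j = b * b ^ P
      instance
        j≢0 : NonZero j
        j≢0 = m*n≢0 b (b ^ P)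
      u = suc (P * j)
      v = N * j
      k = n * j
      instance
        k≢0 : NonZero k
        k≢0 = m*n≢0 n j
      below : ↥ q ℤ.* + k ℤ.< (+ u ℤ.- + v) ℤ.* ↧ q
      below = subst₂ ℤ._<_
        (trans (cong (ℤ._* (+ n ℤ.* + j)) (sym (parts (↥ q)))) (cong (↥ q ℤ.*_) (sym (ℤ.pos-* n j))))
        (trans (sym (e₃ (+ P) (+ N) (+ n) (+ j)))
          (cong₂ (λ s t → (s ℤ.- t) ℤ.* ↧ q) (sym (cast P j)) (sym (ℤ.pos-* N j))))
        (i<i+n ((+ P ℤ.- + N) ℤ.* (+ n ℤ.* + j)))
      powers : b ^ u < a ^ k * b ^ v
      powers = subst₂ _<_ (cong (b *_) (^-*-assoc b P j)) (raise N n j) (magnify (b ^ P) W lt)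

    openʳ : Pow> b a q → Σ[ r ∈ ℚ ] r ℚ.< q × Pow> b a r
    openʳ lt = frac u v k , frac-< q u v k above , frac-upper u v k powers
      where
      j = b * W
      instance
        j≢0 : NonZero j
        j≢0 = m*n≢0 b W
      u = P * j
      v = suc (N * j)
      k = n * j
      instance
        k≢0 : NonZero k
        k≢0 = m*n≢0 n j
      above : (+ u ℤ.- + v) ℤ.* ↧ q ℤ.< ↥ q ℤ.* + k
      above = subst₂ ℤ._<_
        (cong₂ (λ s t → (s ℤ.- t) ℤ.* ↧ q) (sym (ℤ.pos-* P j)) (sym (cast N j)))
        (trans (e₄ (+ P) (+ N) (+ n) (+ j))
          (trans (cong (ℤ._* (+ n ℤ.* + j)) (sym (parts (↥ q)))) (cong (↥ q ℤ.*_) (sym (ℤ.pos-* n j)))))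
        (i<i+n ((+ P ℤ.* + j ℤ.- (ℤ.1ℤ ℤ.+ + N ℤ.* + j)) ℤ.* + n))
      powers : a ^ k * b ^ v < b ^ u
      powers = subst₂ _<_
        (trans (cong (b *_) (raise N n j)) (e₅ b (a ^ k) (b ^ (N * j))))
        (^-*-assoc b P j) (magnify W (b ^ P) lt)
        where
        e₅ : ∀ x y z → x * (y * z) ≡ y * (x * z)
        e₅ = ℕSolver.solve-∀

  n<b^n : ∀ n → n < b ^ n
  n<b^n zero    = s≤s z≤n
  n<b^n (suc n) = ≤-<-trans (n<b^n n) (^-monoʳ-< b 1<b (n<1+n n))

  inhabitedˡ : ∃ (Pow< b a)
  inhabitedˡ = frac 0 1 1 , frac-lower 0 1 1
    (≤-trans 1<b (subst (_≤ a ^ 1 * b ^ 1) (trans (*-identityˡ (b ^ 1)) (^-identityʳ b))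
      (*-monoˡ-≤ (b ^ 1) (subst (1 ≤_) (sym (^-identityʳ a)) 0<a))))

  inhabitedʳ : ∃ (Pow> b a)
  inhabitedʳ = frac a 0 1 , frac-upper a 0 1
    (subst (_< b ^ a) (sym (trans (*-identityʳ (a ^ 1)) (^-identityʳ a))) (n<b^n a))

  Pow<? : ∀ q → Dec (Pow< b a q)
  Pow<? q = _ <? _

  Pow>? : ∀ q → Dec (Pow> b a q)
  Pow>? q = _ <? _

-- log_b a as a cut: q < log_b a iff b ^ q < a, and log_b a < q iff a < b ^ q.
log : (b a : ℕ) → 1 ℕ.< b → 0 ℕ.< a → ℝ
log b a 1<b 0<a = record
  { lower           = Pow< b a
  ; upper           = Pow> b a
  ; lower-inhabited = inhabitedˡ
  ; upper-inhabited = inhabitedʳ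
  ; lower-closed    = λ q<r r<log → K q<r (ℕ.<-asym r<log)
  ; upper-closed    = closed
  ; lower-open      = λ {q} → openˡ q
  ; upper-open      = λ {q} → openʳ q
  ; disjoint        = ℕ.<-asym
  ; located         = loc
  }
  where
  open LogLaws b a 1<b 0<a
  closed : ∀ {q r} → q ℚ.< r → Pow> b a q → Pow> b a r
  closed {q} {r} q<r q>log with Pow>? r
  ... | yes r>log = r>log
  ... | no  r≯log = ⊥-elim (ℕ.<-asym q>log (K q<r r≯log))
  loc : ∀ {q r} → q ℚ.< r → Pow< b a q ⊎ Pow> b a r
  loc {q} {r} q<r with Pow>? r
  ... | yes r>log = inj₂ r>log
  ... | no  r≯log = inj₁ (K q<r r≯log)

-- Finite simple graphs; vertices lists every vertex exactly once.
record Graph : Set₁ where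
  infix 4 _~_ _~?_ _≟_
  field
    Vertex   : Set
    _≟_      : DecidableEquality Vertex
    vertices : List Vertex
    unique   : Unique vertices
    complete : ∀ v → v ∈ vertices
    _~_      : Rel Vertex 0ℓ
    _~?_     : B.Decidable _~_
    ~-sym    : B.Symmetric _~_
    ~-irrefl : ∀ {v} → ¬ v ~ v

  degree : Vertex → ℕ
  degree v = length (filter (v ~?_) vertices)

  card : {A : Pred Vertex 0ℓ} → Decidable A → ℕ
  card A? = length (filter A? vertices)

open Graph

Regular : Graph → ℕ → Set
Regular G d = ∀ v → degree G v ≡ d

-- Every two-element subset of the entries of a duplicate-free list is
-- listed exactly once.
pairs : {X : Set} → List X → List (X × X)
pairs []       = []
pairs (x ∷ xs) = List.map (x ,_) xs ++ pairs xs

edges : (G : Graph) → List (Vertex G × Vertex G)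
edges G = filter (λ (u , v) → _~?_ G u v) (pairs (vertices G))

module _ {X : Set} where
  ExactlyOneIn : Pred X 0ℓ → Pred (X × X) 0ℓ
  ExactlyOneIn A (u , v) = (A u × ¬ A v) ⊎ (¬ A u × A v)

  exactlyOneIn? : {A : Pred X 0ℓ} → Decidable A → Decidable (ExactlyOneIn A)
  exactlyOneIn? A? (u , v) = (A? u ×-dec ¬? (A? v)) ⊎-dec (¬? (A? u) ×-dec A? v)

-- e_G(A, Aᶜ).  Since edges lists each unordered pair in only one of its two
-- orders, either endpoint may be the one lying in A.
boundary : (G : Graph) {A : Pred (Vertex G) 0ℓ} → Decidable A → ℕ
boundary G A? = length (filter (exactlyOneIn? A?) (edges G))

card>0 : (G : Graph) {A : Pred (Vertex G) 0ℓ} (A? : Decidable A) → ∃ A → 0 ℕ.< card G A?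
card>0 G A? (v , v∈A) = ∈-length (∈-filter⁺ A? (complete G v) v∈A)

Tuple : ∀ {n} → Vec Graph n → Set
Tuple []       = ⊤
Tuple (G ∷ Gs) = Vertex G × Tuple Gs

component : ∀ {n} {Gs : Vec Graph n} → Tuple Gs → (i : Fin n) → Vertex (lookup Gs i)
component {Gs = G ∷ Gs} (v , vs) zero    = v
component {Gs = G ∷ Gs} (v , vs) (suc i) = component vs i

AdjacentAt : ∀ {n} {Gs : Vec Graph n} → Fin n → Rel (Tuple Gs) 0ℓ
AdjacentAt {Gs = Gs} j u v =
  _~_ (lookup Gs j) (component u j) (component v j) ×
  (∀ l → l ≢ j → component u l ≡ component v l)

tuple-≟ : ∀ {n} (Gs : Vec Graph n) → DecidableEquality (Tuple Gs)
tuple-≟ []       = _≟⊤_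
tuple-≟ (G ∷ Gs) = ≡-dec (_≟_ G) (tuple-≟ Gs)

tuples : ∀ {n} (Gs : Vec Graph n) → List (Tuple Gs)
tuples []       = tt ∷ []
tuples (G ∷ Gs) = cartesianProduct (vertices G) (tuples Gs)

tuples-unique : ∀ {n} (Gs : Vec Graph n) → Unique (tuples Gs)
tuples-unique []       = [] ∷ []
tuples-unique (G ∷ Gs) = Unique.cartesianProduct⁺ (unique G) (tuples-unique Gs)

tuples-complete : ∀ {n} (Gs : Vec Graph n) (v : Tuple Gs) → v ∈ tuples Gs
tuples-complete []       tt       = here refl
tuples-complete (G ∷ Gs) (v , vs) = ∈-cartesianProduct⁺ (complete G v) (tuples-complete Gs vs)

□ : ∀ {n} → Vec Graph n → Graph
□ Gs = record
  { Vertex   = Tuple Gs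
  ; _≟_      = tuple-≟ Gs
  ; vertices = tuples Gs
  ; unique   = tuples-unique Gs
  ; complete = tuples-complete Gs
  ; _~_      = λ u v → ∃ λ j → AdjacentAt j u v
  ; _~?_     = λ u v → any? λ j →
      _~?_ (lookup Gs j) (component u j) (component v j) ×-dec
      all? λ l → ¬? (l Fin.≟ j) →-dec _≟_ (lookup Gs l) (component u l) (component v l)
  ; ~-sym    = λ (j , adj , eq) → j , ~-sym (lookup Gs j) adj , λ l l≢j → sym (eq l l≢j)
  ; ~-irrefl = λ (j , adj , _) → ~-irrefl (lookup Gs j) adj
  }

{-# OPTIONS --safe #-}

-- Summing degrees over A gives e(A, Aᶜ) + 2 e(A) = d |A|, so the claim is
-- (D + 1) ^ (2 e(A)) ≤ |A| ^ (D |A|).  This goes by induction on the number of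
-- factors.  Cut A into slices indexed by the vertices u of the first factor, let
-- s u be the size of the slice and m u the number of edge ends leaving it for
-- other slices of A.  Then m u ≤ D s u, and s u + m u ≤ |A| because it counts
-- distinct points (v , us) of A with v = u or v ~ u.  Concavity of the logarithm gives
-- (D + 1) ^ m u * s u ^ (D s u) ≤ (s u + m u) ^ (D s u), and the product of these
-- inequalities over u closes the induction.

module Submission where

open import Defs
open import Data.List.Extrema.Nat using (max)
open import Data.Nat.Base using (ℕ; suc; _≥_; s≤s)
open import Data.Product.Base using (∃)
open import Data.Vec.Base using (Vec; lookup; sum; toList)
open import Level using (0ℓ)
open import Relation.Unary using (Pred; Decidable)

open import Data.Bool.Base using (true; false; if_then_else_)
open import Data.Empty using (⊥-elim)
open import Data.Fin.Base using (zero; suc)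
import Data.Fin.Properties as Fin
open import Data.Integer.Base as ℤ using (+_)
import Data.Integer.Properties as ℤ
import Data.Integer.Tactic.RingSolver as ℤSolver
open import Data.List.Base as List using (List; []; _∷_; _++_; length; filter; cartesianProduct)
open import Data.List.Extrema.Nat using (xs≤max)
open import Data.List.Membership.Propositional using (_∈_)
open import Data.List.Relation.Unary.All as All using (All; []; _∷_)
open import Data.List.Relation.Unary.AllPairs using (_∷_)
open import Data.List.Relation.Unary.Any using (here; there)
open import Data.List.Relation.Unary.Unique.Propositional using (Unique)
open import Data.Nat.Base using (zero; _+_; _*_; _∸_; _^_; _≤_; _<_; z≤n; NonZero; >-nonZero; s≤s⁻¹)
open import Data.Nat.ListAction renaming (sum to sumList)
open import Data.Nat.Properties hiding (_≟_)
open import Data.Nat.Tactic.RingSolver using (solve-∀)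
open import Data.Product.Base using (_×_; _,_; proj₁; proj₂)
open import Data.Rational.Base as ℚ using (ℚ; 1ℚ; ↥_; ↧_; ↧ₙ_; toℚᵘ)
import Data.Rational.Properties as ℚ
open import Data.Rational.Solver using (module +-*-Solver)
open import Data.Rational.Unnormalised.Base as ℚᵘ using (mkℚᵘ)
import Data.Rational.Unnormalised.Properties as ℚᵘ
open import Data.Sum.Base using (_⊎_; inj₁; inj₂)
open import Data.Vec.Base using ([]; _∷_)
open import Data.Vec.Membership.Propositional.Properties using (∈-lookup; ∈-toList⁺)
open import Relation.Binary.Definitions using (DecidableEquality)
open import Relation.Binary.PropositionalEquality
open import Relation.Nullary.Decidable using (Dec; yes; no; does; ¬?; _×-dec_; _⊎-dec_)
open import Relation.Nullary.Negation using (¬_)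

open Graph

-- Finite sums and Iverson brackets

∑ : {X : Set} → List X → (X → ℕ) → ℕ
∑ xs f = sumList (List.map f xs)

infixr 8 ∑
syntax ∑ xs (λ x → e) = ∑[ x ← xs ] e

⟦_⟧ : {P : Set} → Dec P → ℕ
⟦ P? ⟧ = if does P? then 1 else 0

⟦⟧≤1 : {P : Set} (P? : Dec P) → ⟦ P? ⟧ ≤ 1
⟦⟧≤1 (yes _) = ≤-refl
⟦⟧≤1 (no  _) = z≤n

⟦⟧-cong : {P Q : Set} (P? : Dec P) (Q? : Dec Q) → (P → Q) → (Q → P) → ⟦ P? ⟧ ≡ ⟦ Q? ⟧
⟦⟧-cong (yes _) (yes _) _   _   = refl
⟦⟧-cong (yes p) (no ¬q) P⇒Q _   = ⊥-elim (¬q (P⇒Q p))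
⟦⟧-cong (no ¬p) (yes q) _   Q⇒P = ⊥-elim (¬p (Q⇒P q))
⟦⟧-cong (no _)  (no _)  _   _   = refl

⟦⟧-no : {P : Set} (P? : Dec P) → ¬ P → ⟦ P? ⟧ ≡ 0
⟦⟧-no (yes p) ¬p = ⊥-elim (¬p p)
⟦⟧-no (no _)  _  = refl

⟦⟧-yes : {P : Set} (P? : Dec P) → P → ⟦ P? ⟧ ≡ 1
⟦⟧-yes (yes _) _ = refl
⟦⟧-yes (no ¬p) p = ⊥-elim (¬p p)

⟦⟧-¬ : {P : Set} (P? : Dec P) → ⟦ P? ⟧ + ⟦ ¬? P? ⟧ ≡ 1
⟦⟧-¬ (yes _) = refl
⟦⟧-¬ (no _)  = refl

⟦⟧-× : {P Q : Set} (P? : Dec P) (Q? : Dec Q) → ⟦ P? ×-dec Q? ⟧ ≡ ⟦ P? ⟧ * ⟦ Q? ⟧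
⟦⟧-× (yes _) (yes _) = refl
⟦⟧-× (yes _) (no _)  = refl
⟦⟧-× (no _)  _       = refl

⟦⟧-⊎ : {P Q : Set} (P? : Dec P) (Q? : Dec Q) → (P → ¬ Q) → ⟦ P? ⊎-dec Q? ⟧ ≡ ⟦ P? ⟧ + ⟦ Q? ⟧
⟦⟧-⊎ (yes p) (yes q) ¬pq = ⊥-elim (¬pq p q)
⟦⟧-⊎ (yes _) (no _)  _   = refl
⟦⟧-⊎ (no _)  (yes _) _   = refl
⟦⟧-⊎ (no _)  (no _)  _   = refl

+-swap-middle : ∀ a b c d → (a + b) + (c + d) ≡ (a + c) + (b + d)
+-swap-middle = solve-∀

∑-cong : {X : Set} (xs : List X) {f g : X → ℕ} → (∀ x → f x ≡ g x) → ∑ xs f ≡ ∑ xs g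
∑-cong []       f≗g = refl
∑-cong (x ∷ xs) f≗g = cong₂ _+_ (f≗g x) (∑-cong xs f≗g)

∑-mono-≤ : {X : Set} (xs : List X) {f g : X → ℕ} → (∀ x → f x ≤ g x) → ∑ xs f ≤ ∑ xs g
∑-mono-≤ []       f≤g = z≤n
∑-mono-≤ (x ∷ xs) f≤g = +-mono-≤ (f≤g x) (∑-mono-≤ xs f≤g)

∑-zero : {X : Set} (xs : List X) → ∑[ x ← xs ] 0 ≡ 0
∑-zero []       = refl
∑-zero (x ∷ xs) = ∑-zero xs

∑-+ : {X : Set} (xs : List X) (f g : X → ℕ) → ∑[ x ← xs ] (f x + g x) ≡ ∑ xs f + ∑ xs g
∑-+ []       f g = refl
∑-+ (x ∷ xs) f g = trans (cong (_+_ (f x + g x)) (∑-+ xs f g))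
  (+-swap-middle (f x) (g x) (∑ xs f) (∑ xs g))

∑-*ˡ : {X : Set} (xs : List X) (c : ℕ) (f : X → ℕ) → ∑[ x ← xs ] (c * f x) ≡ c * ∑ xs f
∑-*ˡ []       c f = sym (*-zeroʳ c)
∑-*ˡ (x ∷ xs) c f = trans (cong (_+_ (c * f x)) (∑-*ˡ xs c f)) (sym (*-distribˡ-+ c (f x) (∑ xs f)))

∑-++ : {X : Set} (xs ys : List X) (f : X → ℕ) → ∑ (xs ++ ys) f ≡ ∑ xs f + ∑ ys f
∑-++ []       ys f = refl
∑-++ (x ∷ xs) ys f = trans (cong (_+_ (f x)) (∑-++ xs ys f)) (sym (+-assoc (f x) (∑ xs f) (∑ ys f)))

∑-map : {X Y : Set} (xs : List X) (g : X → Y) (f : Y → ℕ) → ∑ (List.map g xs) f ≡ ∑[ x ← xs ] f (g x)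
∑-map []       g f = refl
∑-map (x ∷ xs) g f = cong (_+_ (f (g x))) (∑-map xs g f)

∑-swap : {X Y : Set} (xs : List X) (ys : List Y) (f : X → Y → ℕ) →
  ∑[ x ← xs ] ∑[ y ← ys ] f x y ≡ ∑[ y ← ys ] ∑[ x ← xs ] f x y
∑-swap []       ys f = sym (∑-zero ys)
∑-swap (x ∷ xs) ys f = trans (cong (_+_ (∑ ys (f x))) (∑-swap xs ys f))
  (sym (∑-+ ys (f x) (λ y → ∑[ x ← xs ] f x y)))

∑-cartesianProduct : {X Y : Set} (xs : List X) (ys : List Y) (f : X × Y → ℕ) →
  ∑ (cartesianProduct xs ys) f ≡ ∑[ x ← xs ] ∑[ y ← ys ] f (x , y)
∑-cartesianProduct []       ys f = refl
∑-cartesianProduct (x ∷ xs) ys f = trans (∑-++ (List.map (x ,_) ys) (cartesianProduct xs ys) f)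
  (cong₂ _+_ (∑-map ys (x ,_) f) (∑-cartesianProduct xs ys f))

∑-filter : {X : Set} {P : Pred X 0ℓ} (P? : Decidable P) (xs : List X) (f : X → ℕ) →
  ∑ (filter P? xs) f ≡ ∑[ x ← xs ] (⟦ P? x ⟧ * f x)
∑-filter P? []       f = refl
∑-filter P? (x ∷ xs) f with does (P? x)
... | true  = cong₂ _+_ (sym (*-identityˡ (f x))) (∑-filter P? xs f)
... | false = ∑-filter P? xs f

length-filter : {X : Set} {P : Pred X 0ℓ} (P? : Decidable P) (xs : List X) →
  length (filter P? xs) ≡ ∑[ x ← xs ] ⟦ P? x ⟧
length-filter P? []       = refl
length-filter P? (x ∷ xs) with does (P? x)
... | true  = cong suc (length-filter P? xs)
... | false = length-filter P? xs

module _ {X : Set} (_≟ˣ_ : DecidableEquality X) where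

  ∑-absent : ∀ {u} {xs} → All (u ≢_) xs → (f : X → ℕ) → ∑[ v ← xs ] (⟦ u ≟ˣ v ⟧ * f v) ≡ 0
  ∑-absent []           f = refl
  ∑-absent {u} {x ∷ xs} (u≢x ∷ u∉xs) f =
    cong₂ _+_ (cong (_* f x) (⟦⟧-no (u ≟ˣ x) u≢x)) (∑-absent u∉xs f)

  -- Membership supplies one term in which the bracket is 1. Since the list has no duplicates,
  -- `∑-absent` disposes of all others.
  ∑-unique : ∀ {u} {xs} → Unique xs → u ∈ xs → (f : X → ℕ) → ∑[ v ← xs ] (⟦ u ≟ˣ v ⟧ * f v) ≡ f u
  ∑-unique {u} (u∉xs ∷ _) (here refl) f = trans
    (cong₂ _+_ (trans (cong (_* f u) (⟦⟧-yes (u ≟ˣ u) refl)) (*-identityˡ (f u))) (∑-absent u∉xs f))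
    (+-identityʳ (f u))
  ∑-unique {u} {x ∷ _} (x∉xs ∷ distinct) (there u∈xs) f = cong₂ _+_
    (cong (_* f x) (⟦⟧-no (u ≟ˣ x) λ u≡x → All.lookup x∉xs u∈xs (sym u≡x)))
    (∑-unique distinct u∈xs f)

-- `pairs` takes any two positions of the list in one order only. Adding `k` in both orders recovers
-- the double sum off the diagonal, and the diagonal contributes nothing.
∑-pairs : {X : Set} (xs : List X) (k : X → X → ℕ) → (∀ x → k x x ≡ 0) →
  ∑[ p ← pairs xs ] (k (proj₁ p) (proj₂ p) + k (proj₂ p) (proj₁ p)) ≡ ∑[ x ← xs ] ∑[ y ← xs ] k x y
∑-pairs []       k k-diag = refl
∑-pairs (x ∷ xs) k k-diag = begin
  ∑ (List.map (x ,_) xs ++ pairs xs) both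
    ≡⟨ ∑-++ (List.map (x ,_) xs) (pairs xs) both ⟩
  ∑ (List.map (x ,_) xs) both + ∑ (pairs xs) both
    ≡⟨ cong₂ _+_ (trans (∑-map xs (x ,_) both) (∑-+ xs (k x) (λ y → k y x))) (∑-pairs xs k k-diag) ⟩
  (∑ xs (k x) + ∑[ y ← xs ] k y x) + ∑[ y ← xs ] ∑ xs (k y)
    ≡⟨ +-assoc (∑ xs (k x)) _ _ ⟩
  ∑ xs (k x) + (∑[ y ← xs ] k y x + ∑[ y ← xs ] ∑ xs (k y))
    ≡⟨ cong₂ _+_ (cong (_+ ∑ xs (k x)) (sym (k-diag x))) (sym (∑-+ xs (λ y → k y x) (λ y → ∑ xs (k y)))) ⟩
  (k x x + ∑ xs (k x)) + ∑[ y ← xs ] (k y x + ∑ xs (k y))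
    ∎
  where
  open ≡-Reasoning
  both : _ → ℕ
  both (u , v) = k u v + k v u

-- Edge counts

module _ (G : Graph) where

  adj : Vertex G → Vertex G → ℕ
  adj u v = ⟦ _~?_ G u v ⟧

  δ : Vertex G → Vertex G → ℕ
  δ u v = ⟦ _≟_ G u v ⟧

  ∑-δ : ∀ u (f : Vertex G → ℕ) → ∑[ v ← vertices G ] (δ u v * f v) ≡ f u
  ∑-δ u = ∑-unique (_≟_ G) (unique G) (complete G u)

  ∑-adj : ∀ u → ∑[ v ← vertices G ] adj u v ≡ degree G u
  ∑-adj u = sym (length-filter (_~?_ G u) (vertices G))

  adj-sym : ∀ u v → adj u v ≡ adj v u
  adj-sym u v = ⟦⟧-cong (_~?_ G u v) (_~?_ G v u) (~-sym G) (~-sym G)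

  -- There are no loops, so equality and adjacency exclude each other.
  δ+adj≤1 : ∀ u v → δ u v + adj u v ≤ 1
  δ+adj≤1 u v with _≟_ G u v
  ... | yes refl = ≤-reflexive (cong suc (⟦⟧-no (_~?_ G u u) (~-irrefl G)))
  ... | no  _    = ⟦⟧≤1 (_~?_ G u v)

  -- For the indicator function of A, twice the number of edges inside A.
  inner : (Vertex G → ℕ) → ℕ
  inner α = ∑[ u ← vertices G ] (α u * ∑[ v ← vertices G ] (adj u v * α v))

  -- Sum the degrees over the vertices of A and sort the edge ends by where the other end lies: an
  -- edge leaving A is met once, an edge inside A twice.
  boundary+inner : ∀ {d} → Regular G d → {A : Pred (Vertex G) 0ℓ} (A? : Decidable A) →
    boundary G A? + inner (λ v → ⟦ A? v ⟧) ≡ d * card G A?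
  boundary+inner {d} regular {A} A? = begin
    boundary G A? + inner α
      ≡⟨ cong (_+ inner α) boundary≡∑ ⟩
    ∑[ u ← V ] ∑[ v ← V ] k u v + inner α
      ≡⟨ cong (_+ inner α) (∑-cong V λ u → ∑-*ˡ V (α u) (λ v → adj u v * β v)) ⟩
    ∑[ u ← V ] (α u * ∑[ v ← V ] (adj u v * β v)) + inner α
      ≡⟨ ∑-+ V _ _ ⟨
    ∑[ u ← V ] (α u * ∑[ v ← V ] (adj u v * β v) + α u * ∑[ v ← V ] (adj u v * α v))
      ≡⟨ ∑-cong V inside+outside ⟩
    ∑[ u ← V ] (d * α u)
      ≡⟨ ∑-*ˡ V d α ⟩
    d * ∑ V α
      ≡⟨ cong (d *_) (length-filter A? V) ⟨
    d * card G A?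
      ∎
    where
    open ≡-Reasoning
    V = vertices G
    α β : Vertex G → ℕ
    α v = ⟦ A? v ⟧
    β v = ⟦ ¬? (A? v) ⟧

    -- Indicator of the ordered pairs that are edges from A to its complement.
    k : Vertex G → Vertex G → ℕ
    k u v = α u * (adj u v * β v)

    k-diag : ∀ u → k u u ≡ 0
    k-diag u = trans (cong (λ e → α u * (e * β u)) (⟦⟧-no (_~?_ G u u) (~-irrefl G))) (*-zeroʳ (α u))

    factor : ∀ e a b c d → e * (a * b + c * d) ≡ a * (e * b) + d * (e * c)
    factor = solve-∀

    -- The two ways of straddling A exclude each other, so their brackets add. Symmetry of adjacency
    -- turns the second into `k v u`.
    cut≡k+k : ∀ p → let u , v = p in adj u v * ⟦ exactlyOneIn? A? p ⟧ ≡ k u v + k v u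
    cut≡k+k (u , v) = begin
      adj u v * ⟦ exactlyOneIn? A? (u , v) ⟧
        ≡⟨ cong (adj u v *_) (⟦⟧-⊎ (A? u ×-dec ¬? (A? v)) (¬? (A? u) ×-dec A? v) λ (Au , _) (¬Au , _) → ¬Au Au) ⟩
      adj u v * (⟦ A? u ×-dec ¬? (A? v) ⟧ + ⟦ ¬? (A? u) ×-dec A? v ⟧)
        ≡⟨ cong (adj u v *_) (cong₂ _+_ (⟦⟧-× (A? u) (¬? (A? v))) (⟦⟧-× (¬? (A? u)) (A? v))) ⟩
      adj u v * (α u * β v + β u * α v)
        ≡⟨ factor (adj u v) (α u) (β v) (β u) (α v) ⟩
      k u v + α v * (adj u v * β u)
        ≡⟨ cong (λ e → k u v + α v * (e * β u)) (adj-sym u v) ⟩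
      k u v + k v u
        ∎

    boundary≡∑ : boundary G A? ≡ ∑[ u ← V ] ∑[ v ← V ] k u v
    boundary≡∑ = begin
      boundary G A?
        ≡⟨ length-filter (exactlyOneIn? A?) (edges G) ⟩
      ∑[ p ← edges G ] ⟦ exactlyOneIn? A? p ⟧
        ≡⟨ ∑-filter (λ (u , v) → _~?_ G u v) (pairs V) _ ⟩
      ∑[ p ← pairs V ] (adj (proj₁ p) (proj₂ p) * ⟦ exactlyOneIn? A? p ⟧)
        ≡⟨ ∑-cong (pairs V) cut≡k+k ⟩
      ∑[ p ← pairs V ] (k (proj₁ p) (proj₂ p) + k (proj₂ p) (proj₁ p))
        ≡⟨ ∑-pairs V k k-diag ⟩
      ∑[ u ← V ] ∑[ v ← V ] k u v
        ∎

    β+α : ∀ u v → adj u v * β v + adj u v * α v ≡ adj u v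
    β+α u v = begin
      adj u v * β v + adj u v * α v ≡⟨ *-distribˡ-+ (adj u v) (β v) (α v) ⟨
      adj u v * (β v + α v)         ≡⟨ cong (adj u v *_) (trans (+-comm (β v) (α v)) (⟦⟧-¬ (A? v))) ⟩
      adj u v * 1                   ≡⟨ *-identityʳ (adj u v) ⟩
      adj u v                       ∎

    inside+outside : ∀ u →
      α u * ∑[ v ← V ] (adj u v * β v) + α u * ∑[ v ← V ] (adj u v * α v) ≡ d * α u
    inside+outside u = begin
      α u * ∑[ v ← V ] (adj u v * β v) + α u * ∑[ v ← V ] (adj u v * α v)
        ≡⟨ *-distribˡ-+ (α u) _ _ ⟨
      α u * (∑[ v ← V ] (adj u v * β v) + ∑[ v ← V ] (adj u v * α v))
        ≡⟨ cong (α u *_) (sym (∑-+ V _ _)) ⟩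
      α u * ∑[ v ← V ] (adj u v * β v + adj u v * α v)
        ≡⟨ cong (α u *_) (trans (∑-cong V (β+α u)) (trans (∑-adj u) (regular u))) ⟩
      α u * d
        ≡⟨ *-comm (α u) d ⟩
      d * α u
        ∎

-- Products

component-injective : ∀ {n} {Gs : Vec Graph n} (u v : Tuple Gs) →
  (∀ i → component u i ≡ component v i) → u ≡ v
component-injective {Gs = []}    _        _        _  = refl
component-injective {Gs = _ ∷ _} (u , us) (v , vs) eq =
  cong₂ _,_ (eq zero) (component-injective us vs λ i → eq (suc i))

module _ {n} (G : Graph) (Gs : Vec Graph n) where
  private
    H = □ Gs
    V = vertices G
    W = vertices H

  -- An edge at index `zero` moves the first coordinate and fixes the tail; an edge at `suc j` fixes
  -- the first coordinate and moves the tail.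
  adj-□ : ∀ u us v vs → adj (□ (G ∷ Gs)) (u , us) (v , vs) ≡ adj G u v * δ H us vs + δ G u v * adj H us vs
  adj-□ u us v vs = begin
    adj (□ (G ∷ Gs)) (u , us) (v , vs)
      ≡⟨ ⟦⟧-cong (_~?_ (□ (G ∷ Gs)) (u , us) (v , vs)) (inG ⊎-dec inH) split merge ⟩
    ⟦ inG ⊎-dec inH ⟧
      -- Both alternatives at once would give a loop of `G` at `u`.
      ≡⟨ ⟦⟧-⊎ inG inH (λ { (u~u , _) (refl , _) → ~-irrefl G u~u }) ⟩
    ⟦ inG ⟧ + ⟦ inH ⟧
      ≡⟨ cong₂ _+_ (⟦⟧-× (_~?_ G u v) (_≟_ H us vs)) (⟦⟧-× (_≟_ G u v) (_~?_ H us vs)) ⟩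
    adj G u v * δ H us vs + δ G u v * adj H us vs
      ∎
    where
    open ≡-Reasoning
    InG = _~_ G u v × us ≡ vs
    InH = u ≡ v × _~_ H us vs
    inG : Dec InG
    inG = _~?_ G u v ×-dec _≟_ H us vs
    inH : Dec InH
    inH = _≟_ G u v ×-dec _~?_ H us vs

    split : _~_ (□ (G ∷ Gs)) (u , us) (v , vs) → InG ⊎ InH
    split (zero  , u~v , eq) = inj₁ (u~v , component-injective us vs λ i → eq (suc i) λ ())
    split (suc j , u~v , eq) = inj₂
      (eq zero (λ ()) , j , u~v , λ l l≢j → eq (suc l) λ l≡j → l≢j (Fin.suc-injective l≡j))

    merge : InG ⊎ InH → _~_ (□ (G ∷ Gs)) (u , us) (v , vs)
    merge (inj₁ (u~v , refl)) = zero , u~v , λ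
      { zero    0≢0 → ⊥-elim (0≢0 refl)
      ; (suc l) _   → refl }
    merge (inj₂ (refl , j , u~v , eq)) = suc j , u~v , λ
      { zero    _    → refl
      ; (suc l) l≢j → eq l λ l≡j → l≢j (cong suc l≡j) }

  -- The factors `δ` collapse the double sum to one sum in the direction of `G` and one in the
  -- direction of the remaining factors.
  ∑-adj-□ : ∀ u us (f : Vertex G × Tuple Gs → ℕ) →
    ∑[ y ← vertices (□ (G ∷ Gs)) ] (adj (□ (G ∷ Gs)) (u , us) y * f y) ≡
    ∑[ v ← V ] (adj G u v * f (v , us)) + ∑[ vs ← W ] (adj H us vs * f (u , vs))
  ∑-adj-□ u us f = begin
    ∑[ y ← cartesianProduct V W ] (adj (□ (G ∷ Gs)) (u , us) y * f y)
      ≡⟨ ∑-cartesianProduct V W _ ⟩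
    ∑[ v ← V ] ∑[ vs ← W ] (adj (□ (G ∷ Gs)) (u , us) (v , vs) * f (v , vs))
      ≡⟨ ∑-cong V fibre ⟩
    ∑[ v ← V ] (adj G u v * f (v , us) + δ G u v * ∑[ vs ← W ] (adj H us vs * f (v , vs)))
      ≡⟨ ∑-+ V _ _ ⟩
    ∑[ v ← V ] (adj G u v * f (v , us)) + ∑[ v ← V ] (δ G u v * ∑[ vs ← W ] (adj H us vs * f (v , vs)))
      ≡⟨ cong (_+_ _) (∑-δ G u (λ v → ∑[ vs ← W ] (adj H us vs * f (v , vs)))) ⟩
    ∑[ v ← V ] (adj G u v * f (v , us)) + ∑[ vs ← W ] (adj H us vs * f (u , vs))
      ∎
    where
    open ≡-Reasoning
    distribute : ∀ a b c d f → (a * b + c * d) * f ≡ a * (b * f) + c * (d * f)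
    distribute = solve-∀
    fibre : ∀ v → ∑[ vs ← W ] (adj (□ (G ∷ Gs)) (u , us) (v , vs) * f (v , vs)) ≡
      adj G u v * f (v , us) + δ G u v * ∑[ vs ← W ] (adj H us vs * f (v , vs))
    fibre v = begin
      ∑[ vs ← W ] (adj (□ (G ∷ Gs)) (u , us) (v , vs) * f (v , vs))
        ≡⟨ ∑-cong W (λ vs → trans (cong (_* f (v , vs)) (adj-□ u us v vs))
             (distribute (adj G u v) (δ H us vs) (δ G u v) (adj H us vs) (f (v , vs)))) ⟩
      ∑[ vs ← W ] (adj G u v * (δ H us vs * f (v , vs)) + δ G u v * (adj H us vs * f (v , vs)))
        ≡⟨ ∑-+ W _ _ ⟩
      ∑[ vs ← W ] (adj G u v * (δ H us vs * f (v , vs))) + ∑[ vs ← W ] (δ G u v * (adj H us vs * f (v , vs)))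
        ≡⟨ cong₂ _+_ (∑-*ˡ W (adj G u v) _) (∑-*ˡ W (δ G u v) _) ⟩
      adj G u v * ∑[ vs ← W ] (δ H us vs * f (v , vs)) + δ G u v * ∑[ vs ← W ] (adj H us vs * f (v , vs))
        ≡⟨ cong (λ s → adj G u v * s + δ G u v * ∑[ vs ← W ] (adj H us vs * f (v , vs)))
             (∑-δ H us (λ vs → f (v , vs))) ⟩
      adj G u v * f (v , us) + δ G u v * ∑[ vs ← W ] (adj H us vs * f (v , vs))
        ∎

□-regular : ∀ {n} (Gs : Vec Graph n) (ds : Vec ℕ n) →
  (∀ i → Regular (lookup Gs i) (lookup ds i)) → Regular (□ Gs) (sum ds)
□-regular []       []       regular _        = refl
□-regular (G ∷ Gs) (d ∷ ds) regular (u , us) = begin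
  degree (□ (G ∷ Gs)) (u , us)
    ≡⟨ ∑-adj (□ (G ∷ Gs)) (u , us) ⟨
  ∑[ y ← vertices (□ (G ∷ Gs)) ] adj (□ (G ∷ Gs)) (u , us) y
    -- The constant weight 1 brings the count of neighbours into the form of `∑-adj-□`.
    ≡⟨ ∑-cong (vertices (□ (G ∷ Gs))) (λ y → sym (*-identityʳ (adj (□ (G ∷ Gs)) (u , us) y))) ⟩
  ∑[ y ← vertices (□ (G ∷ Gs)) ] (adj (□ (G ∷ Gs)) (u , us) y * 1)
    ≡⟨ ∑-adj-□ G Gs u us (λ _ → 1) ⟩
  ∑[ v ← vertices G ] (adj G u v * 1) + ∑[ vs ← vertices (□ Gs) ] (adj (□ Gs) us vs * 1)
    ≡⟨ cong₂ _+_ (∑-cong (vertices G) λ v → *-identityʳ (adj G u v))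
         (∑-cong (vertices (□ Gs)) λ vs → *-identityʳ (adj (□ Gs) us vs)) ⟩
  ∑[ v ← vertices G ] adj G u v + ∑[ vs ← vertices (□ Gs) ] adj (□ Gs) us vs
    ≡⟨ cong₂ _+_ (trans (∑-adj G u) (regular zero u))
         (trans (∑-adj (□ Gs) us) (□-regular Gs ds (λ i → regular (suc i)) us)) ⟩
  d + sum ds
    ∎
  where open ≡-Reasoning

-- The numerical inequality

-- For positive q and K, the factor (K + 1) / K is at most (q + 1) / q as long as q ≤ K. Taken at q,
-- q + 1, ..., q + s - 1, these bounds telescope to (q + s) / q.
bernoulli-step : ∀ K q s → q + s ≤ suc K → suc K ^ s * q ≤ K ^ s * (q + s)
bernoulli-step K q zero    _   = ≤-reflexive (cong (1 *_) (sym (+-identityʳ q)))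
bernoulli-step K q (suc s) q+s≤K = begin
  suc K * suc K ^ s * q         ≡⟨ rotate (suc K) (suc K ^ s) q ⟩
  suc K ^ s * (q + K * q)       ≤⟨ *-monoʳ-≤ (suc K ^ s) (+-monoˡ-≤ (K * q) q≤K) ⟩
  suc K ^ s * (K + K * q)       ≡⟨ factor (suc K ^ s) K q ⟩
  K * (suc K ^ s * suc q)       ≤⟨ *-monoʳ-≤ K (bernoulli-step K (suc q) s (≤-trans (≤-reflexive (sym (+-suc q s))) q+s≤K)) ⟩
  K * (K ^ s * (suc q + s))     ≡⟨ trans (sym (*-assoc K (K ^ s) (suc q + s))) (cong (K * K ^ s *_) (sym (+-suc q s))) ⟩
  K * K ^ s * (q + suc s)       ∎
  where
  open ≤-Reasoning
  rotate : ∀ k p q → k * p * q ≡ p * (k * q)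
  rotate = solve-∀
  factor : ∀ p K q → p * (K + K * q) ≡ K * (p * suc q)
  factor = solve-∀
  q≤K : q ≤ K
  q≤K = ≤-trans (m≤m+n q s) (s≤s⁻¹ (≤-trans (≤-reflexive (sym (+-suc q s))) q+s≤K))

-- Weighted AM-GM: q + s is the mean of q and q + (r + s) with weights r and s.
am-gm : ∀ q r s → q ^ r * (q + (r + s)) ^ s ≤ (q + s) ^ (r + s)
am-gm q zero    s = ≤-reflexive (*-identityˡ ((q + s) ^ s))
am-gm q (suc r) s = begin
  q * q ^ r * (q + suc (r + s)) ^ s   ≡⟨ cong (λ k → q * q ^ r * k ^ s) (+-suc q (r + s)) ⟩
  q * q ^ r * suc K ^ s               ≡⟨ rotate q (q ^ r) (suc K ^ s) ⟩
  -- Lowering the larger entry from `suc K` to `K` is paid for by replacing one factor `q` with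
  -- `q + s`. What remains is the case of weights `r` and `s`.
  q ^ r * (suc K ^ s * q)             ≤⟨ *-monoʳ-≤ (q ^ r) (bernoulli-step K q s (m≤n⇒m≤1+n (+-monoʳ-≤ q (m≤n+m s r)))) ⟩
  q ^ r * (K ^ s * (q + s))           ≡⟨ permute (q ^ r) (K ^ s) (q + s) ⟩
  (q + s) * (q ^ r * K ^ s)           ≤⟨ *-monoʳ-≤ (q + s) (am-gm q r s) ⟩
  (q + s) * (q + s) ^ (r + s)         ∎
  where
  open ≤-Reasoning
  K = q + (r + s)
  rotate : ∀ k p q → k * p * q ≡ p * (q * k)
  rotate = solve-∀
  permute : ∀ x y z → x * (y * z) ≡ z * (x * y)
  permute = solve-∀

^-distribʳ-* : ∀ x y n → (x * y) ^ n ≡ x ^ n * y ^ n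
^-distribʳ-* x y zero    = refl
^-distribʳ-* x y (suc n) = trans (cong (x * y *_) (^-distribʳ-* x y n)) (swap-middle x y (x ^ n) (y ^ n))
  where
  swap-middle : ∀ x y z w → x * y * (z * w) ≡ x * z * (y * w)
  swap-middle = solve-∀

-- With t = s / q this is t ≤ D log_{D+1}(1 + t) for 0 ≤ t ≤ D, which holds by
-- concavity since both sides agree at t = 0 and t = D.
concavity : ∀ D q s → s ≤ D * q → suc D ^ s * q ^ (D * q) ≤ (q + s) ^ (D * q)
concavity D q s s≤Dq = begin
  suc D ^ s * q ^ (D * q)         ≡⟨ cong (λ n → suc D ^ s * q ^ n) (sym r+s) ⟩
  suc D ^ s * q ^ (r + s)         ≡⟨ cong (suc D ^ s *_) (^-distribˡ-+-* q r s) ⟩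
  suc D ^ s * (q ^ r * q ^ s)     ≡⟨ permute (suc D ^ s) (q ^ r) (q ^ s) ⟩
  q ^ r * (suc D ^ s * q ^ s)     ≡⟨ cong (q ^ r *_) (^-distribʳ-* (suc D) q s) ⟨
  q ^ r * (q + D * q) ^ s         ≡⟨ cong (λ n → q ^ r * (q + n) ^ s) (sym r+s) ⟩
  q ^ r * (q + (r + s)) ^ s       ≤⟨ am-gm q r s ⟩
  (q + s) ^ (r + s)               ≡⟨ cong ((q + s) ^_) r+s ⟩
  (q + s) ^ (D * q)               ∎
  where
  open ≤-Reasoning
  -- The weights `r` and `s` add up to D q, which makes the larger entry `q + (r + s)` of `am-gm`
  -- equal to (D + 1) q.
  r = D * q ∸ s
  r+s : r + s ≡ D * q
  r+s = m∸n+n≡m s≤Dq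
  permute : ∀ x y z → x * (y * z) ≡ y * (x * z)
  permute = solve-∀

-- The inequalities are multiplied over the list. They share the bases `b` and `a`, so the exponents
-- add up.
^-∑-≤ : {X : Set} (xs : List X) (b a D : ℕ) (f g : X → ℕ) →
  (∀ x → b ^ f x ≤ a ^ (D * g x)) → b ^ ∑ xs f ≤ a ^ (D * ∑ xs g)
^-∑-≤ []       b a D f g _  = ≤-reflexive (cong (a ^_) (sym (*-zeroʳ D)))
^-∑-≤ (x ∷ xs) b a D f g le = begin
  b ^ (f x + ∑ xs f)                   ≡⟨ ^-distribˡ-+-* b (f x) (∑ xs f) ⟩
  b ^ f x * b ^ ∑ xs f                 ≤⟨ *-mono-≤ (le x) (^-∑-≤ xs b a D f g le) ⟩
  a ^ (D * g x) * a ^ (D * ∑ xs g)     ≡⟨ ^-distribˡ-+-* a (D * g x) (D * ∑ xs g) ⟨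
  a ^ (D * g x + D * ∑ xs g)           ≡⟨ cong (a ^_) (*-distribˡ-+ D (g x) (∑ xs g)) ⟨
  a ^ (D * (g x + ∑ xs g))             ∎
  where open ≤-Reasoning

-- At n = 0 the exponent vanishes and 0 ^ 0 is 1. This convention lets empty slices through the
-- induction.
1≤n^[D*n] : ∀ D n → 1 ≤ n ^ (D * n)
1≤n^[D*n] D zero    = ≤-reflexive (cong (0 ^_) (sym (*-zeroʳ D)))
1≤n^[D*n] D (suc n) = m^n>0 (suc n) (D * suc n)

-- Induction on the number of factors

-- Sets are replaced by functions with values at most 1, because fixing the first coordinate gives
-- such a function again, possibly zero. `D` is any common bound on the degrees, so that the tail of
-- `ds` inherits it.
inner-bound : ∀ {n} (Gs : Vec Graph n) (ds : Vec ℕ n) (D : ℕ) →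
  (∀ i → Regular (lookup Gs i) (lookup ds i)) → (∀ i → lookup ds i ≤ D) →
  (α : Tuple Gs → ℕ) → (∀ x → α x ≤ 1) →
  let a = ∑ (vertices (□ Gs)) α in suc D ^ inner (□ Gs) α ≤ a ^ (D * a)
inner-bound [] [] D _ _ α _ = begin
  -- The empty product has one vertex and no edge, so `inner` computes to this vanishing exponent.
  suc D ^ (α _ * 0 + 0)    ≡⟨ cong (suc D ^_) (trans (+-identityʳ (α _ * 0)) (*-zeroʳ (α _))) ⟩
  1                        ≤⟨ 1≤n^[D*n] D (α _ + 0) ⟩
  (α _ + 0) ^ (D * (α _ + 0)) ∎
  where open ≤-Reasoning
inner-bound (G ∷ Gs) (d ∷ ds) D regular ds≤D α α≤1 = begin
  suc D ^ inner (□ (G ∷ Gs)) α       ≡⟨ cong (suc D ^_) inner-split ⟩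
  suc D ^ ∑[ u ← V ] (m u + e u)     ≤⟨ ^-∑-≤ V (suc D) a D (λ u → m u + e u) s slice-bound ⟩
  a ^ (D * a)                        ≡⟨ cong (λ n → n ^ (D * n)) (∑-cartesianProduct V W α) ⟨
  ∑ (cartesianProduct V W) α ^ (D * ∑ (cartesianProduct V W) α) ∎
  where
  open ≤-Reasoning
  H = □ Gs
  V = vertices G
  W = vertices H
  s e m : Vertex G → ℕ
  s u = ∑[ us ← W ] α (u , us)
  e u = inner H (λ us → α (u , us))
  m u = ∑[ us ← W ] (α (u , us) * ∑[ v ← V ] (adj G u v * α (v , us)))
  a = ∑ V s

  -- An edge end at a point of slice `u` either leads to another slice, counted by `m u`, or stays
  -- in the slice, counted by `e u`.
  inner-split : inner (□ (G ∷ Gs)) α ≡ ∑[ u ← V ] (m u + e u)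
  inner-split = trans (∑-cartesianProduct V W _) (∑-cong V λ u →
    trans (∑-cong W λ us → trans (cong (α (u , us) *_) (∑-adj-□ G Gs u us α)) (*-distribˡ-+ (α (u , us)) _ _))
      (∑-+ W _ _))

  neighbours≤D : ∀ u us → ∑[ v ← V ] (adj G u v * α (v , us)) ≤ D
  neighbours≤D u us = begin
    ∑[ v ← V ] (adj G u v * α (v , us))
      ≤⟨ ∑-mono-≤ V (λ v → ≤-trans (*-monoʳ-≤ (adj G u v) (α≤1 (v , us))) (≤-reflexive (*-identityʳ _))) ⟩
    ∑ V (adj G u)
      ≡⟨ trans (∑-adj G u) (regular zero u) ⟩
    d
      ≤⟨ ds≤D zero ⟩
    D
      ∎

  m≤D*s : ∀ u → m u ≤ D * s u
  m≤D*s u = begin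
    m u
      ≤⟨ ∑-mono-≤ W (λ us → ≤-trans (*-monoʳ-≤ (α (u , us)) (neighbours≤D u us)) (≤-reflexive (*-comm _ D))) ⟩
    ∑[ us ← W ] (D * α (u , us))
      ≡⟨ ∑-*ˡ W D (λ us → α (u , us)) ⟩
    D * s u
      ∎

  closed-neighbourhood : ∀ u us →
    α (u , us) + α (u , us) * ∑[ v ← V ] (adj G u v * α (v , us)) ≤ ∑[ v ← V ] α (v , us)
  closed-neighbourhood u us = begin
    α (u , us) + α (u , us) * ∑[ v ← V ] (adj G u v * α (v , us))
      ≤⟨ +-monoʳ-≤ (α (u , us)) (≤-trans (*-monoˡ-≤ _ (α≤1 (u , us))) (≤-reflexive (*-identityˡ _))) ⟩
    α (u , us) + ∑[ v ← V ] (adj G u v * α (v , us))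
      ≡⟨ cong (_+ ∑[ v ← V ] (adj G u v * α (v , us))) (∑-δ G u (λ v → α (v , us))) ⟨
    ∑[ v ← V ] (δ G u v * α (v , us)) + ∑[ v ← V ] (adj G u v * α (v , us))
      ≡⟨ ∑-+ V _ _ ⟨
    ∑[ v ← V ] (δ G u v * α (v , us) + adj G u v * α (v , us))
      ≤⟨ ∑-mono-≤ V (λ v → ≤-trans (≤-reflexive (sym (*-distribʳ-+ (α (v , us)) (δ G u v) (adj G u v))))
           (≤-trans (*-monoˡ-≤ (α (v , us)) (δ+adj≤1 G u v)) (≤-reflexive (*-identityˡ _)))) ⟩
    ∑[ v ← V ] α (v , us)
      ∎

  s+m≤a : ∀ u → s u + m u ≤ a
  s+m≤a u = begin
    s u + m u                            ≡⟨ ∑-+ W _ _ ⟨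
    _                                    ≤⟨ ∑-mono-≤ W (closed-neighbourhood u) ⟩
    ∑[ us ← W ] ∑[ v ← V ] α (v , us)    ≡⟨ ∑-swap W V (λ us v → α (v , us)) ⟩
    a                                    ∎

  -- The induction hypothesis treats the edges inside the slice and `concavity` absorbs those
  -- leaving it. Enlarging the base to `a` gives all slices the same base, as `^-∑-≤` requires.
  slice-bound : ∀ u → suc D ^ (m u + e u) ≤ a ^ (D * s u)
  slice-bound u = begin
    suc D ^ (m u + e u)               ≡⟨ ^-distribˡ-+-* (suc D) (m u) (e u) ⟩
    suc D ^ m u * suc D ^ e u         ≤⟨ *-monoʳ-≤ (suc D ^ m u) (inner-bound Gs ds D
                                           (λ i → regular (suc i)) (λ i → ds≤D (suc i))
                                           (λ us → α (u , us)) (λ us → α≤1 (u , us))) ⟩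
    suc D ^ m u * s u ^ (D * s u)     ≤⟨ concavity D (s u) (m u) (m≤D*s u) ⟩
    (s u + m u) ^ (D * s u)           ≤⟨ ^-monoˡ-≤ (D * s u) (s+m≤a u) ⟩
    a ^ (D * s u)                     ∎

-- Real numbers

open ℝ

module _ where
  open +-*-Solver

  *-distrib-- : ∀ x y z c → x ℚ.* (y ℚ.- z ℚ.* c) ≡ y ℚ.* x ℚ.- (z ℚ.* x) ℚ.* c
  *-distrib-- = solve 4 (λ x y z c → x :* (y :- z :* c) := y :* x :- (z :* x) :* c) refl

  x+y-y≡x : ∀ x y → x ℚ.+ y ℚ.- y ≡ x
  x+y-y≡x = solve 2 (λ x y → x :+ y :- y := x) refl

ι : ℕ → ℚ
ι n = + n ℚ./ 1

-- Going through `×ℚ` with unit step reduces the claim to a defining equation, without unfolding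
-- normalised fractions.
ι-suc : ∀ n → ι (suc n) ≡ 1ℚ ℚ.+ ι n
ι-suc n = begin
  ι (suc n)            ≡⟨ trans (sym (ℚ.*-identityʳ (ι (suc n)))) (sym (×ℚ-* (suc n) 1ℚ)) ⟩
  1ℚ ℚ.+ n ×ℚ 1ℚ       ≡⟨ cong (1ℚ ℚ.+_) (trans (×ℚ-* n 1ℚ) (ℚ.*-identityʳ (ι n))) ⟩
  1ℚ ℚ.+ ι n           ∎
  where open ≡-Reasoning

ι-+ : ∀ m n → ι (m + n) ≡ ι m ℚ.+ ι n
ι-+ zero    n = sym (ℚ.+-identityˡ (ι n))
ι-+ (suc m) n = begin
  ι (suc (m + n))              ≡⟨ ι-suc (m + n) ⟩
  1ℚ ℚ.+ ι (m + n)             ≡⟨ cong (1ℚ ℚ.+_) (ι-+ m n) ⟩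
  1ℚ ℚ.+ (ι m ℚ.+ ι n)         ≡⟨ ℚ.+-assoc 1ℚ (ι m) (ι n) ⟨
  (1ℚ ℚ.+ ι m) ℚ.+ ι n         ≡⟨ cong (ℚ._+ ι n) (ι-suc m) ⟨
  ι (suc m) ℚ.+ ι n            ∎
  where open ≡-Reasoning

ι-* : ∀ m n → ι (m * n) ≡ ι m ℚ.* ι n
ι-* zero    n = sym (ℚ.*-zeroˡ (ι n))
ι-* (suc m) n = begin
  ι (n + m * n)                ≡⟨ ι-+ n (m * n) ⟩
  ι n ℚ.+ ι (m * n)            ≡⟨ cong₂ ℚ._+_ (sym (ℚ.*-identityˡ (ι n))) (ι-* m n) ⟩
  1ℚ ℚ.* ι n ℚ.+ ι m ℚ.* ι n   ≡⟨ ℚ.*-distribʳ-+ (ι n) 1ℚ (ι m) ⟨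
  (1ℚ ℚ.+ ι m) ℚ.* ι n         ≡⟨ cong (ℚ._* ι n) (ι-suc m) ⟨
  ι (suc m) ℚ.* ι n            ∎
  where open ≡-Reasoning

-- The bound p ≤ x is phrased through the upper cut, since the lower cut of a negated real consists
-- of the negatives of its upper cut; `sub-lower` uses it in this form.
·-upper : ∀ n {x p} → (∀ {w} → upper x w → p ℚ.< w) → ∀ {w} → upper (n · x) w → n ×ℚ p ℚ.< w
·-upper zero    p<x 0<w = 0<w
·-upper (suc n) {x} p<x (a , b , ua , ub , a+b<w) =
  ℚ.<-trans (ℚ.+-mono-< (p<x ua) (·-upper n {x} p<x ub)) a+b<w

·-lower : ∀ n {x p} → x ≤ᴿ fromℚ p → n · x ≤ᴿ fromℚ (n ×ℚ p)
·-lower zero    x≤p q<0 = q<0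
·-lower (suc n) {x} x≤p (a , b , la , lb , q<a+b) =
  ℚ.<-trans q<a+b (ℚ.+-mono-< (x≤p la) (·-lower n {x} x≤p lb))

sub-lower : ∀ {y p} r → (∀ {w} → upper y w → p ℚ.< w) → fromℚ r -ᴿ y ≤ᴿ fromℚ (r ℚ.- p)
sub-lower {p = p} r p<y (a , b , a<r , u-b , q<a+b) =
  ℚ.<-trans q<a+b (ℚ.+-mono-< a<r (subst (ℚ._< ℚ.- p) (neg-involutive b) (ℚ.neg-antimono-< (p<y u-b))))
  where open import Algebra.Properties.Group ℚ.+-0-group using () renaming (⁻¹-involutive to neg-involutive)

-- From the power inequality to the logarithm

EdgeBoundary≥ : (B d D b a : ℕ) → 1 < b → 0 < a → Set
EdgeBoundary≥ B d D b a 1<b 0<a = fromℕ B ≥ᴿ a · (fromℕ d -ᴿ D · log b a 1<b 0<a)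

module _ (b a : ℕ) (1<b : 1 < b) (0<a : 0 < a) where
  open LogLaws b a 1<b 0<a using (frac; frac-<; compare-<ʳ; parts)

  -- The hypothesis says that e / k is at most the logarithm to base b of a, and the logarithm is
  -- less than `w`.
  log-upper : ∀ e k .{{_ : NonZero k}} → b ^ e ≤ a ^ k →
    ∀ {w} → upper (log b a 1<b 0<a) w → frac e 0 k ℚ.< w
  -- `compare-<ʳ` yields e n + N k < P k. Subtracting N k in the integers leaves e n < (P - N) k,
  -- which is e / k < w with denominators cleared.
  log-upper e k b^e≤a^k {w} log<w = frac-< w e 0 k (subst₂ ℤ._<_ left right
    (ℤ.+-monoˡ-< (ℤ.- + (N * k)) (ℤ.+<+ (compare-<ʳ P N n e 0 k
      (subst (b ^ e ≤_) (sym (*-identityʳ (a ^ k))) b^e≤a^k) log<w))))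
    where
    P = posPart (↥ w)
    N = negPart (↥ w)
    n = ↧ₙ w
    left : + (e * n + N * k) ℤ.- + (N * k) ≡ (+ e ℤ.- + 0) ℤ.* ↧ w
    left = begin
      + (e * n + N * k) ℤ.- + (N * k)           ≡⟨ cong (ℤ._- + (N * k)) (ℤ.pos-+ (e * n) (N * k)) ⟩
      + (e * n) ℤ.+ + (N * k) ℤ.- + (N * k)     ≡⟨ cong (λ i → i ℤ.+ + (N * k) ℤ.- + (N * k)) (ℤ.pos-* e n) ⟩
      + e ℤ.* + n ℤ.+ + (N * k) ℤ.- + (N * k)   ≡⟨ cancel (+ e) (+ n) (+ (N * k)) ⟩
      (+ e ℤ.- + 0) ℤ.* ↧ w                     ∎
      where
      open ≡-Reasoning
      cancel : ∀ e n x → e ℤ.* n ℤ.+ x ℤ.- x ≡ (e ℤ.- + 0) ℤ.* n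
      cancel = ℤSolver.solve-∀
    right : + (P * k) ℤ.- + (N * k) ≡ ↥ w ℤ.* + k
    right = begin
      + (P * k) ℤ.- + (N * k)          ≡⟨ cong₂ ℤ._-_ (ℤ.pos-* P k) (ℤ.pos-* N k) ⟩
      + P ℤ.* + k ℤ.- + N ℤ.* + k      ≡⟨ factor (+ P) (+ N) (+ k) ⟩
      (+ P ℤ.- + N) ℤ.* + k            ≡⟨ cong (ℤ._* + k) (parts (↥ w)) ⟨
      ↥ w ℤ.* + k                      ∎
      where
      open ≡-Reasoning
      factor : ∀ P N k → P ℤ.* k ℤ.- N ℤ.* k ≡ (P ℤ.- N) ℤ.* k
      factor = ℤSolver.solve-∀

  ι*frac : ∀ e k .{{_ : NonZero k}} → ι k ℚ.* frac e 0 k ≡ ι e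
  ι*frac e (suc k) = ℚ.toℚᵘ-injective (begin
    toℚᵘ (ι (suc k) ℚ.* frac e 0 (suc k))
      ≈⟨ ℚ.toℚᵘ-homo-* (ι (suc k)) (frac e 0 (suc k)) ⟩
    toℚᵘ (ι (suc k)) ℚᵘ.* toℚᵘ (frac e 0 (suc k))
      ≈⟨ ℚᵘ.*-cong (ℚ.toℚᵘ-fromℚᵘ (mkℚᵘ (+ suc k) 0)) (ℚ.toℚᵘ-fromℚᵘ (mkℚᵘ (+ e ℤ.- + 0) k)) ⟩
    mkℚᵘ (+ suc k) 0 ℚᵘ.* mkℚᵘ (+ e ℤ.- + 0) k
      ≈⟨ ℚᵘ.*≡* (trans (commute (+ suc k) (+ e)) (cong (λ n → + e ℤ.* + n) (sym (*-identityˡ (suc k))))) ⟩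
    mkℚᵘ (+ e) 0
      ≈⟨ ℚ.toℚᵘ-fromℚᵘ (mkℚᵘ (+ e) 0) ⟨
    toℚᵘ (ι e) ∎)
    where
    open ℚᵘ.≃-Reasoning
    commute : ∀ k e → k ℤ.* (e ℤ.- + 0) ℤ.* + 1 ≡ e ℤ.* k
    commute = ℤSolver.solve-∀

  -- Put c = e / (D a). The power inequality bounds the logarithm below by c, so the right-hand side
  -- is at most a (d - D c) = d a - e = B.
  log-bound : ∀ B d D e → D ≥ 1 → B + e ≡ d * a → b ^ e ≤ a ^ (D * a) →
    EdgeBoundary≥ B d D b a 1<b 0<a
  log-bound B d D e D≥1 B+e≡da b^e≤ {q} q∈ = subst (q ℚ.<_) value
    (·-lower a {x} (sub-lower {D · l} (ι d) (·-upper D {l} (log-upper e (D * a) b^e≤))) q∈)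
    where
    instance
      Da≢0 : NonZero (D * a)
      Da≢0 = m*n≢0 D a {{>-nonZero D≥1}} {{>-nonZero 0<a}}
    c = frac e 0 (D * a)
    l = log b a 1<b 0<a
    x = fromℕ d -ᴿ D · l
    open ≡-Reasoning
    value : a ×ℚ (ι d ℚ.- D ×ℚ c) ≡ ι B
    value = begin
      a ×ℚ (ι d ℚ.- D ×ℚ c)                      ≡⟨ ×ℚ-* a _ ⟩
      ι a ℚ.* (ι d ℚ.- D ×ℚ c)                   ≡⟨ cong (λ x → ι a ℚ.* (ι d ℚ.- x)) (×ℚ-* D c) ⟩
      ι a ℚ.* (ι d ℚ.- ι D ℚ.* c)                ≡⟨ *-distrib-- (ι a) (ι d) (ι D) c ⟩
      ι d ℚ.* ι a ℚ.- (ι D ℚ.* ι a) ℚ.* c        ≡⟨ cong₂ (λ x y → x ℚ.- y ℚ.* c) (ι-* d a) (ι-* D a) ⟨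
      ι (d * a) ℚ.- ι (D * a) ℚ.* c              ≡⟨ cong₂ (λ n x → ι n ℚ.- x) (sym B+e≡da) (ι*frac e (D * a)) ⟩
      ι (B + e) ℚ.- ι e                          ≡⟨ cong (ℚ._- ι e) (ι-+ B e) ⟩
      ι B ℚ.+ ι e ℚ.- ι e                        ≡⟨ x+y-y≡x (ι B) (ι e) ⟩
      ι B                                        ∎

-- The 0 is the starting value of `max`; as the least natural number it does not change the maximum
-- of a nonempty vector.
lookup≤max : ∀ {n} (ds : Vec ℕ n) i → lookup ds i ≤ max 0 (toList ds)
lookup≤max ds i = All.lookup (xs≤max 0 (toList ds)) (∈-toList⁺ (∈-lookup i ds))

isoperimetry : ∀ {n} (Gs : Vec Graph n) (ds : Vec ℕ n) (D : ℕ) →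
  (∀ i → Regular (lookup Gs i) (lookup ds i)) → (∀ i → lookup ds i ≤ D) → D ≥ 1 →
  (A : Pred (Tuple Gs) 0ℓ) (A? : Decidable A) (1<D+1 : 1 < suc D) (0<∣A∣ : 0 < card (□ Gs) A?) →
  EdgeBoundary≥ (boundary (□ Gs) A?) (sum ds) D (suc D) (card (□ Gs) A?) 1<D+1 0<∣A∣
-- A is given explicitly so that it is not inferred as λ v → A v: on terms that
-- are not syntactically equal, Agda compares the reals by unfolding the cuts.
isoperimetry Gs ds D regular ds≤D D≥1 A A? 1<D+1 0<∣A∣ =
  log-bound (suc D) (card (□ Gs) {A} A?) 1<D+1 0<∣A∣ (boundary (□ Gs) {A} A?) (sum ds) D (inner (□ Gs) α) D≥1
    (boundary+inner (□ Gs) (□-regular Gs ds regular) {A} A?)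
    (subst (λ a → suc D ^ inner (□ Gs) α ≤ a ^ (D * a)) (sym (length-filter {P = A} A? (vertices (□ Gs))))
      (inner-bound Gs ds D regular ds≤D α (λ x → ⟦⟧≤1 (A? x))))
  where
  α : Tuple Gs → ℕ
  α x = ⟦ A? x ⟧

mainTheorem3 : ∀ (n : ℕ) → n ≥ 1 →
    (Gs : Vec Graph n) (ds : Vec ℕ n) →
    (∀ i → Regular (lookup Gs i) (lookup ds i)) →
    let 𝐆 = □ Gs
        d = sum ds
        D = max 0 (toList ds) in
    (D≥1 : D ≥ 1) →
    (A : Pred (Graph.Vertex 𝐆) 0ℓ) (A? : Decidable A) (A≢∅ : ∃ A) →
    let ∣A∣ = Graph.card 𝐆 A? in
    fromℕ (boundary 𝐆 A?) ≥ᴿ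
      ∣A∣ · (fromℕ d -ᴿ D · log (suc D) ∣A∣ (s≤s D≥1) (card>0 𝐆 A? A≢∅))
mainTheorem3 n n≥1 Gs ds regular D≥1 A A? A≢∅ =
  -- Writing max 0 (toList ds) for the first underscore makes the conversion check
  -- against the goal unfold the cuts, and it then does not finish.
  isoperimetry Gs ds _ regular (lookup≤max ds) D≥1 A A? _ _
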